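{- Let $P$ be a finite poset on ground set $I$. Then the antipode of $J(P)$ is given by the cancellation-free (and grouping-free) formula $$\mathrm{S}(J(P),I)=\sum_{Q\in\mathrm{Good}(P)}(-1)^{c(Q)+|P\setminus Q|}\,(J(Q),I),$$ where $c(Q)$ is the number of components of $Q$; the set families $(J(Q),I)$, $Q\in\mathrm{Good}(P)$, are pairwise distinct.
   Context: A grounded set family on $I$ is $(\mathcal{F},I)$ with $\emptyset\in\mathcal{F}\subseteq 2^I$; the join of families on disjoint ground sets is $\mathcal{F}_1*\mathcal{F}_2=\{X\cup Y:X\in\mathcal{F}_1,Y\in\mathcal{F}_2\}$. For a set composition $\Phi=\Phi_1|\cdots|\Phi_m\models I$ (ordered partition into nonempty blocks, $|\Phi|=m$), let $\mathcal{F}_i=\{A\cap\Phi_i:A\in\mathcal{F},\ A\cap\Phi_j=\emptyset\ \forall j<i\}$ and $\mu_\Phi\Delta_\Phi(\mathcal{F},I)=(\mathcal{F}_1*\cdots*\mathcal{F}_m,I)$. The antipode (in the Hopf monoid of lattices of order ideals, a submonoid of the Hopf monoid of grounded set families with join product, restriction $\mathcal{F}|_S=\{F\cap S\}$ and contraction $\mathcal{F}/_S=\{F:F\cap S=\emptyset\}$) is the linear map on the vector space with basis the grounded set families on $I$ given by $\mathrm{S}(\mathcal{F},I)=\sum_{\Phi\models I}(-1)^{|\Phi|}\mu_\Phi\Delta_\Phi(\mathcal{F},I)$. $J(P)$ is the family of order ideals of $P$. A fracturing of $P$ is a poset $Q$ on a subset of $P$ that is a disjoint union of induced subposets of $P$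 ($x<_Qy$ iff same summand and $x<_Py$); its components are the connected components of its Hasse diagram. $Q$ is good if there is $\Phi\models I$ with $\mu_\Phi\Delta_\Phi(J(P),I)=(J(Q),I)$; $\mathrm{Good}(P)$ is the set of good fracturings of $P$. -}

module Defs where

open import Level using (0ℓ)
open import Data.Bool using (Bool; true; false; _∧_; _∨_; not; if_then_else_; T; T?)
open import Data.Nat as ℕ using (ℕ; zero; suc; _∸_)
open import Data.Fin as Fin using (Fin; toℕ)
open import Data.Fin.Properties using () renaming (_≟_ to _≟F_)
open import Data.Fin.Subset using (Subset; _∩_; _∪_; ⊥; ∣_∣; _∈_)
open import Data.Vec as Vec using (Vec; []; _∷_; lookup)
open import Data.Vec.Properties using (≡-dec)
open import Data.List as List using (List; []; _∷_; map; concatMap; allFin; upTo; foldr; length; filter)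
open import Data.Bool.ListAction using (any; all)
open import Data.Integer as ℤ using (ℤ; -1ℤ; _^_)
open import Data.Product using (Σ; ∃; _×_; _,_)
open import Relation.Binary using (Rel; IsDecPartialOrder)
open import Relation.Binary.PropositionalEquality using (_≡_)
open import Relation.Nullary.Decidable using (⌊_⌋)
import Data.Bool.Properties as BoolP

allSubsets : (n : ℕ) → List (Subset n)
allSubsets zero    = [] ∷ []
allSubsets (suc n) = map (true ∷_) (allSubsets n) List.++ map (false ∷_) (allSubsets n)

allVecs : (m n : ℕ) → List (Vec (Fin m) n)
allVecs m zero    = [] ∷ []
allVecs m (suc n) = concatMap (λ i → map (i ∷_) (allVecs m n)) (allFin m)

_≟S_ : ∀ {n} (X Y : Subset n) → Bool
X ≟S Y = ⌊ ≡-dec BoolP._≟_ X Y ⌋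

_=F_ : ∀ {k} (i j : Fin k) → Bool
i =F j = ⌊ i ≟F j ⌋

anyFin : ∀ {k} → (Fin k → Bool) → Bool
anyFin f = any f (allFin _)

allFin? : ∀ {k} → (Fin k → Bool) → Bool
allFin? f = all f (allFin _)

mem : ∀ {n} → Fin n → Subset n → Bool
mem x X = lookup X x

-- Set families on I = Fin n, given by their (decidable) membership
-- predicate on subsets of I.  Two families are the same family iff
-- they have the same members.

Family : ℕ → Set
Family n = Subset n → Bool

_≐_ : ∀ {n} → Family n → Family n → Set
F ≐ G = ∀ X → F X ≡ G X

_≐?_ : ∀ {n} → Family n → Family n → Bool
F ≐? G = all (λ X → ⌊ BoolP._≟_ (F X) (G X) ⌋) (allSubsets _)

_*_ : ∀ {n} → Family n → Family n → Family n
(F * G) Z = any (λ X → any (λ Y → F X ∧ G Y ∧ (Z ≟S (X ∪ Y))) (allSubsets _)) (allSubsets _)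

unitFam : ∀ {n} → Family n
unitFam Z = Z ≟S ⊥

-- Set compositions.  A set composition Φ = Φ₁|…|Φₘ of I = Fin n into
-- m nonempty blocks is encoded by the block map φ : Fin n → Fin m
-- (x ∈ Φ_{i+1} iff φ x = i), required to be surjective (blocks nonempty).

block : ∀ {n m} → (Fin n → Fin m) → Fin m → Subset n
block φ i = Vec.tabulate (λ x → φ x =F i)

restrictContract : ∀ {n m} → (Fin n → Fin m) → Family n → Fin m → Family n
restrictContract φ F i Y =
  any (λ A → F A
             ∧ allFin? (λ j → if ⌊ toℕ j ℕ.<? toℕ i ⌋ then (A ∩ block φ j) ≟S ⊥ else true)
             ∧ (Y ≟S (A ∩ block φ i)))
      (allSubsets _)

μΔ : ∀ {n m} → (Fin n → Fin m) → Family n → Family n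
μΔ φ F = foldr (λ i G → restrictContract φ F i * G) unitFam (allFin _)

isSurj : ∀ {n m} → (Fin n → Fin m) → Bool
isSurj φ = allFin? (λ i → anyFin (λ x → φ x =F i))

record Composition (n : ℕ) : Set where
  field
    m    : ℕ
    φ    : Fin n → Fin m
    surj : ∀ i → ∃ λ x → φ x ≡ i

sign : ℕ → ℤ
sign k = -1ℤ ^ k

-- Coefficient of the basis element (G, I) in
--   S(F, I) = Σ_{Φ ⊨ I} (-1)^{|Φ|} μ_Φ Δ_Φ (F, I),
-- the sum running over all set compositions Φ of I (m = |Φ| ≤ n).
antipodeCoeff : ∀ {n} → Family n → Family n → ℤ
antipodeCoeff {n} F G =
  List.foldr ℤ._+_ ℤ.0ℤ
    (concatMap (λ m →
       map (λ v → let φ = lookup v in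
                  if isSurj φ ∧ (μΔ φ F ≐? G) then sign m else ℤ.0ℤ)
           (allVecs m n))
     (upTo (suc n)))

record FinPoset (n : ℕ) : Set₁ where
  field
    _≤_          : Rel (Fin n) 0ℓ
    isDecPartialOrder : IsDecPartialOrder _≡_ _≤_
  open IsDecPartialOrder isDecPartialOrder public using (_≤?_)

  leq : Fin n → Fin n → Bool
  leq x y = ⌊ x ≤? y ⌋

JP : ∀ {n} → FinPoset n → Family n
JP P X = allFin? (λ x → allFin? (λ y →
           not (leq y x ∧ mem x X) ∨ mem y X))
  where open FinPoset P

-- Fracturings of P.  A fracturing Q is a poset on a subset S ⊆ I which is
-- a disjoint union of induced subposets of P: the summands are the
-- fibres over S of a labelling `summand : Fin n → Fin n`, and
--   x ≤_Q y  iff  x, y ∈ S and (x = y or (same summand and x ≤_P y)).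

record Fracturing {n : ℕ} (P : FinPoset n) : Set where
  field
    S       : Subset n
    summand : Fin n → Fin n

module _ {n : ℕ} {P : FinPoset n} (Q : Fracturing P) where
  open FinPoset P
  open Fracturing Q

  leqQ : Fin n → Fin n → Bool
  leqQ x y = mem x S ∧ mem y S ∧ ((x =F y) ∨ ((summand x =F summand y) ∧ leq x y))

  ltQ : Fin n → Fin n → Bool
  ltQ x y = leqQ x y ∧ not (x =F y)

  JQ : Family n
  JQ X = allFin? (λ x → not (mem x X) ∨ mem x S)
       ∧ allFin? (λ x → allFin? (λ y → not (leqQ y x ∧ mem x X) ∨ mem y X))

  coversQ : Fin n → Fin n → Bool
  coversQ x y = ltQ x y ∧ not (anyFin (λ z → ltQ x z ∧ ltQ z y))

  hasseEdge : Fin n → Fin n → Bool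
  hasseEdge x y = coversQ x y ∨ coversQ y x

  reach : ℕ → Fin n → Fin n → Bool
  reach zero    x y = mem x S ∧ (x =F y)
  reach (suc t) x y = reach t x y ∨ anyFin (λ z → reach t x z ∧ hasseEdge z y)

  connected : Fin n → Fin n → Bool
  connected = reach n

  -- c(Q): number of connected components of the Hasse diagram of Q,
  -- counted as the number of x ∈ S that are the least element of their component
  components : ℕ
  components = length (filter (λ x → T? (mem x S ∧ not (anyFin (λ y → ⌊ toℕ y ℕ.<? toℕ x ⌋ ∧ connected y x))))
                              (allFin n))

  removed : ℕ
  removed = n ∸ ∣ S ∣

SamePoset : ∀ {n} {P : FinPoset n} → Fracturing P → Fracturing P → Set
SamePoset Q Q' = (Fracturing.S Q ≡ Fracturing.S Q') × (∀ x y → leqQ Q x y ≡ leqQ Q' x y)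

Good : ∀ {n} (P : FinPoset n) → Fracturing P → Set
Good P Q = Σ (Composition _) λ Φ → μΔ (Composition.φ Φ) (JP P) ≐ JQ Q

{-# OPTIONS --safe #-}
module Submission where

-- Write x ≤_φ y when x ≤ y, φ x = φ y and φ y ≤ φ z for all z ≤ y. Then μ_Φ Δ_Φ J(P) consists of
-- the order ideals of ≤_φ on its reflexive points, and such a family determines its order. So the
-- coefficient of a good Q is the sum of (-1)^m over all surjections φ : I → [m] with ≤_φ = ≤_Q.
-- They are described by one condition per point x, relating φ x to the labels of points that come
-- before x when the points are sorted by a composition witnessing goodness, removed points last.
-- For x removed, φ x exceeds the label of some point of Q below x; for x the least index in its
-- component of Q, φ x exceeds the labels of certain points of Q; any other point of Q has the label
-- of an earlier point of its component.
-- The alternating sum is an Euler characteristic and is computed by fibring over the points in this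
-- order: a lower bound leaves an open ray, of Euler characteristic -1, and a tie leaves a point, of
-- Euler characteristic 1. The product of these factors is (-1)^(c(Q) + |P∖Q|).

open import Defs
open import Data.Bool using (Bool; true; false; _∧_; _∨_; not; if_then_else_; T; T?)
open import Data.Bool.ListAction using (any; all)
open import Data.Bool.Properties using (T-∧; T-∨; T-≡; ∨-comm)
open import Data.Empty using (⊥-elim)
open import Data.Fin as Fin
  using (Fin; zero; suc; toℕ; punchIn; punchOut; inject₁; fromℕ; combine)
import Data.Fin.Properties as FinP
open FinP
  using (punchInᵢ≢i; punchIn-injective; punchIn-punchOut; punchIn-mono-≤; punchIn-cancel-≤;
         injective⇒≤; any?)
  renaming (_≟_ to _≟F_)
open import Data.Fin.Subset using (Subset; _∩_; _∪_; ⊥; ∣_∣)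
open import Data.Fin.Subset.Properties using (∣p∣≤n; p⊂q⇒∣p∣<∣q∣)
import Data.Integer as ℤ hiding (+_)
open ℤ using (ℤ; 0ℤ; 1ℤ; -1ℤ; -_)
import Data.Integer.Properties as ℤP
import Data.List as List
open List using (List; []; _∷_; _++_; allFin; concatMap; applyUpTo; tabulate; filter; length)
open import Data.List.Membership.Propositional using () renaming (_∈_ to _∈L_)
open import Data.List.Membership.Propositional.Properties
  using (∈-allFin; ∈-++⁺ˡ; ∈-++⁺ʳ; ∈-map⁺)
open import Data.List.Properties using (map-++; map-∘)
import Data.List.Relation.Unary.Any as Any
open Any using (here; there)
import Data.List.Relation.Unary.Any.Properties as AnyP
open import Data.Nat as ℕ using (ℕ; zero; suc; _+_; _∸_; _≤_; _<_; z≤n; s≤s)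
import Data.Nat.Properties as ℕP
open import Data.Product using (∃; ∃₂; _×_; _,_; proj₁; proj₂)
open import Data.Sum using (_⊎_; inj₁; inj₂; [_,_]′)
open import Data.Unit using (tt)
open import Data.Vec as Vec using (Vec; []; _∷_; lookup; insertAt)
open import Data.Vec.Properties
  using (insertAt-lookup; insertAt-punchIn; lookup-map; lookup∘tabulate; tabulate∘lookup;
         tabulate-cong; lookup-zipWith; lookup-replicate; lookup⇒[]=; []=⇒lookup)
open import Function using (_∘_; id; Equivalence; _⇔_; mk⇔)
open import Function.Construct.Composition using (_⇔-∘_)
open import Function.Construct.Symmetry using (⇔-sym)
open import Relation.Binary using (IsDecPartialOrder; tri<; tri≈; tri>)
open import Relation.Binary.Construct.Closure.ReflexiveTransitive
  using (Star; ε; _◅_; _◅◅_; reverse)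
open import Relation.Binary.PropositionalEquality
  using (_≡_; _≢_; refl; sym; trans; cong; cong₂; subst; subst₂; module ≡-Reasoning)
open import Relation.Nullary using (¬_; Dec; yes; no; contradiction)
open import Relation.Nullary.Decidable using (⌊_⌋; toWitness; fromWitness; _×-dec_)
open import Algebra.Properties.CommutativeMonoid.Sum ℤP.+-0-commutativeMonoid
  using (sum; sum-cong-≗; ∑-distrib-+; ∑-comm; sum-remove; sum-init-last)
open import Algebra.Properties.CommutativeMonoid.Sum ℤP.*-1-commutativeMonoid
  using ()
  renaming (sum to prod; sum-cong-≗ to prod-cong; sum-remove to prod-remove; ∑-distrib-+ to prod-*)

-- Boolean reflection

-- A set composition with `m` blocks is a relatively open cell of dimension `m` of the braid
-- arrangement in real `n`-space, and all conditions used depend only on the relative order of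
-- labels. The alternating sum is thus a compactly supported Euler characteristic, for which Fubini
-- holds. The obstacle is the order of integration. A point can be integrated out only when no other
-- remaining condition mentions it, and for an arbitrary fracturing the strict bounds between
-- components may be cyclic. A composition witnessing goodness satisfies all of them at once, so
-- sorting by its labels makes every bound refer backwards. The factors multiply because a fibre has
-- the same Euler characteristic wherever the earlier points lie: the position alone on top
-- satisfies every conjunction of lower bounds and every disjunction with at least one term, so the
-- region is never empty.

T-ext : ∀ {a b} → (T a → T b) → (T b → T a) → a ≡ b
T-ext {false} {false} _ _ = refl
T-ext {false} {true}  _ g = ⊥-elim (g tt)
T-ext {true}  {false} f _ = ⊥-elim (f tt)
T-ext {true}  {true}  _ _ = refl

∧⁺ : ∀ {a b} → T a → T b → T (a ∧ b)
∧⁺ p q = Equivalence.from T-∧ (p , q)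

∧⁻ : ∀ {a b} → T (a ∧ b) → T a × T b
∧⁻ = Equivalence.to T-∧

∨⁺ : ∀ {a b} → T a ⊎ T b → T (a ∨ b)
∨⁺ = Equivalence.from T-∨

∨⁻ : ∀ {a b} → T (a ∨ b) → T a ⊎ T b
∨⁻ = Equivalence.to T-∨

not⁺ : ∀ {a} → ¬ T a → T (not a)
not⁺ {true}  f = f tt
not⁺ {false} _ = tt

not⁻ : ∀ {a} → T (not a) → ¬ T a
not⁻ {false} _ ()

⇒⁺ : ∀ {a b} → (T a → T b) → T (not a ∨ b)
⇒⁺ {true}  f = f tt
⇒⁺ {false} _ = tt

⇒⁻ : ∀ {a b} → T (not a ∨ b) → T a → T b
⇒⁻ {true} p _ = p

T-dec : ∀ b → T b ⊎ ¬ T b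
T-dec true  = inj₁ tt
T-dec false = inj₂ id

if-true : ∀ {A : Set} {b} {u v : A} → T b → (if b then u else v) ≡ u
if-true {b = true} _ = refl

if-false : ∀ {A : Set} {b} {u v : A} → ¬ T b → (if b then u else v) ≡ v
if-false {b = true}  h = ⊥-elim (h tt)
if-false {b = false} _ = refl

module _ {A : Set} (f : A → Bool) where

  any⁺ : ∀ {x xs} → x ∈L xs → T (f x) → T (any f xs)
  any⁺ x∈ fx = AnyP.any⁺ f (Any.map (λ eq → subst (T ∘ f) eq fx) x∈)

  any⁻ : ∀ xs → T (any f xs) → ∃ λ x → T (f x)
  any⁻ xs t = Any.satisfied (AnyP.any⁻ f xs t)

  all⁺ : ∀ xs → (∀ x → T (f x)) → T (all f xs)
  all⁺ []       _ = tt
  all⁺ (x ∷ xs) h = ∧⁺ (h x) (all⁺ xs h)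

  all⁻ : ∀ {x xs} → T (all f xs) → x ∈L xs → T (f x)
  all⁻ t (here refl) = proj₁ (∧⁻ t)
  all⁻ {xs = y ∷ _} t (there x∈) = all⁻ (proj₂ (∧⁻ {f y} t)) x∈

module _ {k : ℕ} {f : Fin k → Bool} where

  anyFin⁺ : ∀ x → T (f x) → T (anyFin f)
  anyFin⁺ x = any⁺ f (∈-allFin x)

  anyFin⁻ : T (anyFin f) → ∃ λ x → T (f x)
  anyFin⁻ = any⁻ f (allFin k)

  allFin⁺ : (∀ x → T (f x)) → T (allFin? f)
  allFin⁺ = all⁺ f (allFin k)

  allFin⁻ : T (allFin? f) → ∀ x → T (f x)
  allFin⁻ t x = all⁻ f t (∈-allFin x)

=F⁺ : ∀ {k} {i j : Fin k} → i ≡ j → T (i =F j)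
=F⁺ = fromWitness

=F⁻ : ∀ {k} {i j : Fin k} → T (i =F j) → i ≡ j
=F⁻ = toWitness

module _ {n m : ℕ} {φ : Fin n → Fin m} where

  isSurj⁺ : (∀ i → ∃ λ x → φ x ≡ i) → T (isSurj φ)
  isSurj⁺ s = allFin⁺ λ i → anyFin⁺ (proj₁ (s i)) (=F⁺ (proj₂ (s i)))

  isSurj⁻ : T (isSurj φ) → ∀ i → ∃ λ x → φ x ≡ i
  isSurj⁻ t i with anyFin⁻ {f = λ x → φ x =F i} (allFin⁻ {f = λ i → anyFin (λ x → φ x =F i)} t i)
  ... | x , e = x , =F⁻ e

  surj⇒≤ : (∀ i → ∃ λ x → φ x ≡ i) → m ≤ n
  surj⇒≤ s = injective⇒≤ {f = proj₁ ∘ s}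
    (λ {i} {j} e → trans (sym (proj₂ (s i))) (trans (cong φ e) (proj₂ (s j))))

-- Alternating sums over surjections

infixr 7 _⊙_
_⊙_ : Bool → ℤ → ℤ
b ⊙ x = if b then x else 0ℤ

⊙-∧ : ∀ a b x → (a ∧ b) ⊙ x ≡ a ⊙ b ⊙ x
⊙-∧ true  b x = refl
⊙-∧ false b x = refl

⊙-distrib-+ : ∀ b x y → b ⊙ (x ℤ.+ y) ≡ b ⊙ x ℤ.+ b ⊙ y
⊙-distrib-+ true  x y = refl
⊙-distrib-+ false x y = refl

⊙-neg : ∀ b x → b ⊙ (- x) ≡ - (b ⊙ x)
⊙-neg true  x = refl
⊙-neg false x = refl

⊙-false : ∀ {b} x → ¬ T b → b ⊙ x ≡ 0ℤ
⊙-false x = if-false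

⊙-true : ∀ {b} x → T b → b ⊙ x ≡ x
⊙-true x = if-true

sum-zero : ∀ {k} {f : Fin k → ℤ} → (∀ i → f i ≡ 0ℤ) → sum f ≡ 0ℤ
sum-zero {zero}  h = refl
sum-zero {suc k} h = cong₂ ℤ._+_ (h zero) (sum-zero (h ∘ suc))

sum-neg : ∀ {k} (f : Fin k → ℤ) → sum (λ i → - f i) ≡ - sum f
sum-neg {zero}  f = refl
sum-neg {suc k} f =
  trans (cong (λ z → (- f zero) ℤ.+ z) (sum-neg (f ∘ suc)))
        (sym (ℤP.neg-distrib-+ (f zero) (sum (f ∘ suc))))

sum-⊙ : ∀ {k} b (f : Fin k → ℤ) → sum (λ i → b ⊙ f i) ≡ b ⊙ sum f
sum-⊙ true  f = refl
sum-⊙ {k} false f = sum-zero {k} λ _ → refl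

sum-single : ∀ {k} (i : Fin k) x → sum (λ j → (j =F i) ⊙ x) ≡ x
sum-single {suc k} i x = trans (sum-remove {i = i} (λ j → (j =F i) ⊙ x))
  (trans (cong₂ ℤ._+_ (⊙-true x (=F⁺ {i = i} refl))
                      (sum-zero λ j → ⊙-false x (punchInᵢ≢i i j ∘ =F⁻)))
         (ℤP.+-identityʳ x))

module _ {m : ℕ} where

  ΣV : ∀ n → (Vec (Fin m) n → ℤ) → ℤ
  ΣV zero    f = f []
  ΣV (suc n) f = sum λ i → ΣV n λ v → f (i ∷ v)

  ΣV-cong : ∀ n {f g : Vec (Fin m) n → ℤ} → (∀ v → f v ≡ g v) → ΣV n f ≡ ΣV n g
  ΣV-cong zero    h = h []
  ΣV-cong (suc n) h = sum-cong-≗ λ i → ΣV-cong n λ v → h (i ∷ v)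

  ΣV-zero : ∀ n {f : Vec (Fin m) n → ℤ} → (∀ v → f v ≡ 0ℤ) → ΣV n f ≡ 0ℤ
  ΣV-zero zero    h = h []
  ΣV-zero (suc n) h = sum-zero λ i → ΣV-zero n λ v → h (i ∷ v)

  ΣV-+ : ∀ n (f g : Vec (Fin m) n → ℤ) → ΣV n (λ v → f v ℤ.+ g v) ≡ ΣV n f ℤ.+ ΣV n g
  ΣV-+ zero    f g = refl
  ΣV-+ (suc n) f g = trans (sum-cong-≗ λ i → ΣV-+ n (f ∘ (i ∷_)) (g ∘ (i ∷_)))
    (∑-distrib-+ (λ i → ΣV n (f ∘ (i ∷_))) (λ i → ΣV n (g ∘ (i ∷_))))

  ΣV-neg : ∀ n (f : Vec (Fin m) n → ℤ) → ΣV n (λ v → - f v) ≡ - ΣV n f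
  ΣV-neg zero    f = refl
  ΣV-neg (suc n) f = trans (sum-cong-≗ λ i → ΣV-neg n (f ∘ (i ∷_))) (sum-neg λ i → ΣV n (f ∘ (i ∷_)))

  ΣV-sum : ∀ n {k} (f : Fin k → Vec (Fin m) n → ℤ) →
           sum (λ i → ΣV n (f i)) ≡ ΣV n (λ v → sum λ i → f i v)
  ΣV-sum n {zero}  f = sym (ΣV-zero n λ _ → refl)
  ΣV-sum n {suc k} f = trans (cong (ΣV n (f zero) ℤ.+_) (ΣV-sum n (f ∘ suc)))
    (sym (ΣV-+ n (f zero) (λ v → sum λ i → f (suc i) v)))

  ΣV-insertAt : ∀ n (p : Fin (suc n)) (f : Vec (Fin m) (suc n) → ℤ) →
                ΣV (suc n) f ≡ sum λ i → ΣV n λ v → f (insertAt v p i)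
  ΣV-insertAt n       zero    f = refl
  ΣV-insertAt (suc n) (suc p) f =
    trans (sum-cong-≗ λ j → trans (ΣV-insertAt n p (f ∘ (j ∷_)))
                                  (ΣV-sum n λ i v → f (j ∷ insertAt v p i)))
    (ΣV-sum-comm n λ j i v → f (j ∷ insertAt v p i))
    where
    ΣV-sum-comm : ∀ n (g : Fin m → Fin m → Vec (Fin m) n → ℤ) →
      sum (λ j → ΣV n (λ v → sum λ i → g j i v)) ≡ sum (λ i → sum λ j → ΣV n (g j i))
    ΣV-sum-comm n g = trans (ΣV-sum n λ j v → sum λ i → g j i v)
      (trans (ΣV-cong n λ v → ∑-comm λ j i → g j i v)
      (trans (sym (ΣV-sum n λ i v → sum λ j → g j i v))
             (sum-cong-≗ λ i → sym (ΣV-sum n λ j → g j i))))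

misses : ∀ {n m} → Fin m → Vec (Fin m) n → Bool
misses i []      = true
misses i (j ∷ v) = not (j =F i) ∧ misses i v

misses⁻ : ∀ {n m} {i : Fin m} (v : Vec (Fin m) n) → T (misses i v) → ∀ x → lookup v x ≢ i
misses⁻ {i = i} (j ∷ v) t zero    e = not⁻ (proj₁ (∧⁻ {not (j =F i)} t)) (=F⁺ e)
misses⁻ {i = i} (j ∷ v) t (suc x) e = misses⁻ v (proj₂ (∧⁻ {not (j =F i)} t)) x e

¬misses⇒hit : ∀ {n m} {i : Fin m} (v : Vec (Fin m) n) → ¬ T (misses i v) → ∃ λ x → lookup v x ≡ i
¬misses⇒hit []      h = ⊥-elim (h tt)
¬misses⇒hit {i = i} (j ∷ v) h with j ≟F i
... | yes e = zero , e
... | no  _ with ¬misses⇒hit v h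
...   | x , e = suc x , e

-- Skipping the label `i` is a bijection from `Fin m` onto the other labels; applied entrywise it
-- reaches each vector avoiding `i` exactly once.
ΣV-misses : ∀ {m} n (i : Fin (suc m)) (f : Vec (Fin (suc m)) n → ℤ) →
            ΣV n (λ v → misses i v ⊙ f v) ≡ ΣV n (λ v → f (Vec.map (punchIn i) v))
ΣV-misses zero    i f = refl
ΣV-misses (suc n) i f = trans
  (sum-remove {i = i} (λ j → ΣV n λ v → (not (j =F i) ∧ misses i v) ⊙ f (j ∷ v)))
  (trans (cong₂ ℤ._+_
      (ΣV-zero n λ v → ⊙-false (f (i ∷ v)) λ t → not⁻ (proj₁ (∧⁻ {not (i =F i)} t)) (=F⁺ {i = i} refl))
      (sum-cong-≗ λ k → trans
         (ΣV-cong n λ v → cong (_⊙ f (punchIn i k ∷ v))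
            (T-ext (proj₂ ∘ ∧⁻ {not (punchIn i k =F i)}) (∧⁺ (not⁺ (punchInᵢ≢i i k ∘ =F⁻)))))
         (ΣV-misses n i (f ∘ (punchIn i k ∷_)))))
    (ℤP.+-identityˡ _))

ΣS : ∀ m n → (Vec (Fin m) n → ℤ) → ℤ
ΣS m n f = ΣV n λ v → isSurj (lookup v) ⊙ f v

ΣS-cong : ∀ m n {f g : Vec (Fin m) n → ℤ} → (∀ v → f v ≡ g v) → ΣS m n f ≡ ΣS m n g
ΣS-cong m n h = ΣV-cong n λ v → cong (isSurj (lookup v) ⊙_) (h v)

ΣS-neg : ∀ m n (f : Vec (Fin m) n → ℤ) → ΣS m n (λ v → - f v) ≡ - ΣS m n f
ΣS-neg m n f = trans (ΣV-cong n λ v → ⊙-neg (isSurj (lookup v)) (f v))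
  (ΣV-neg n λ v → isSurj (lookup v) ⊙ f v)

ΣS-+ : ∀ m n (f g : Vec (Fin m) n → ℤ) → ΣS m n (λ v → f v ℤ.+ g v) ≡ ΣS m n f ℤ.+ ΣS m n g
ΣS-+ m n f g = trans (ΣV-cong n λ v → ⊙-distrib-+ (isSurj (lookup v)) (f v) (g v))
  (ΣV-+ n (λ v → isSurj (lookup v) ⊙ f v) (λ v → isSurj (lookup v) ⊙ g v))

ΣS-vanish : ∀ {m n} → n < m → ∀ f → ΣS m n f ≡ 0ℤ
ΣS-vanish {m} {n} n<m f = ΣV-zero n λ v →
  ⊙-false (f v) λ t → ℕP.<⇒≱ n<m (surj⇒≤ (isSurj⁻ {φ = lookup v} t))

-- Opens a new block at position `g` containing `p` alone: `punchIn g` moves the labels from `g` on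
-- up by one.
punch : ∀ {m n} → Fin (suc m) → Fin (suc n) → Vec (Fin m) n → Vec (Fin (suc m)) (suc n)
punch g p v = insertAt (Vec.map (punchIn g) v) p g

module _ {n m : ℕ} (v : Vec (Fin m) n) (p : Fin (suc n)) (i : Fin m) where

  lookup-insertAt-≢ : ∀ x → (p≢x : p ≢ x) → lookup (insertAt v p i) x ≡ lookup v (punchOut p≢x)
  lookup-insertAt-≢ x p≢x = trans
    (cong (lookup (insertAt v p i)) (sym (punchIn-punchOut p≢x))) (insertAt-punchIn v p i _)

  isSurj-insertAt⁺ : T (isSurj (lookup v)) → T (isSurj (lookup (insertAt v p i)))
  isSurj-insertAt⁺ t = isSurj⁺ λ j → let x , e = isSurj⁻ {φ = lookup v} t j in
    punchIn p x , trans (insertAt-punchIn v p i x) e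

  isSurj-insertAt⁻ : T (isSurj (lookup (insertAt v p i))) → ∀ j → j ≢ i → ∃ λ x → lookup v x ≡ j
  isSurj-insertAt⁻ t j j≢i with isSurj⁻ {φ = lookup (insertAt v p i)} t j
  ... | x , e with p ≟F x
  ...   | yes refl = contradiction (trans (sym e) (insertAt-lookup v p i)) j≢i
  ...   | no  p≢x  = punchOut p≢x , trans (sym (lookup-insertAt-≢ x p≢x)) e

  -- If `v` misses `i`, it is not surjective and `p` is alone in block `i`; if `v` hits `i`,
  -- inserting `p` adds no label and leaves surjectivity as it was. So at most one summand is
  -- nonzero.
  isSurj-split : ∀ x → isSurj (lookup (insertAt v p i)) ⊙ x ≡
    isSurj (lookup v) ⊙ x ℤ.+ misses i v ⊙ isSurj (lookup (insertAt v p i)) ⊙ x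
  isSurj-split x with T-dec (misses i v)
  ... | inj₁ t = sym (trans
    (cong₂ ℤ._+_ (⊙-false x λ s → let y , e = isSurj⁻ {φ = lookup v} s i in misses⁻ v t y e)
                 (⊙-true _ t)) (ℤP.+-identityˡ _))
  ... | inj₂ f = sym (trans
    (cong₂ ℤ._+_ (cong (_⊙ x) (T-ext isSurj-insertAt⁺ back)) (⊙-false _ f)) (ℤP.+-identityʳ _))
    where
    back : T (isSurj (lookup (insertAt v p i))) → T (isSurj (lookup v))
    back t = isSurj⁺ surjective
      where
      surjective : ∀ j → ∃ λ x → lookup v x ≡ j
      surjective j with j ≟F i
      ... | yes refl = ¬misses⇒hit v f
      ... | no  j≢i  = isSurj-insertAt⁻ t j j≢i

isSurj-punch : ∀ {m n} (g : Fin (suc m)) (p : Fin (suc n)) (v : Vec (Fin m) n) →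
               isSurj (lookup (punch g p v)) ≡ isSurj (lookup v)
isSurj-punch g p v = T-ext to from
  where
  to : T (isSurj (lookup (punch g p v))) → T (isSurj (lookup v))
  to t = isSurj⁺ λ j →
    let x , e = isSurj-insertAt⁻ (Vec.map (punchIn g) v) p g t (punchIn g j) (punchInᵢ≢i g j)
    in x , punchIn-injective g _ _ (trans (sym (lookup-map x (punchIn g) v)) e)
  from : T (isSurj (lookup v)) → T (isSurj (lookup (punch g p v)))
  from t = isSurj⁺ λ j → hit j
    where
    hit : ∀ j → ∃ λ x → lookup (punch g p v) x ≡ j
    hit j with g ≟F j
    ... | yes refl = p , insertAt-lookup (Vec.map (punchIn g) v) p g
    ... | no  g≢j  = let x , e = isSurj⁻ {φ = lookup v} t (punchOut g≢j) in
      punchIn p x , trans (insertAt-punchIn (Vec.map (punchIn g) v) p g x)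
        (trans (lookup-map x (punchIn g) v) (trans (cong (punchIn g) e) (punchIn-punchOut g≢j)))

-- With no labels there is no block for `p` to occupy, hence the value 0.
ΣS-punch : ∀ m n → Fin (suc n) → (Vec (Fin m) (suc n) → ℤ) → ℤ
ΣS-punch zero    n p f = 0ℤ
ΣS-punch (suc m) n p f = ΣS m n λ v → sum λ g → f (punch g p v)

-- Deleting the point p from a surjection leaves a surjection, unless p was alone in its block.
ΣS-insertAt : ∀ m n (p : Fin (suc n)) (f : Vec (Fin m) (suc n) → ℤ) →
  ΣS m (suc n) f ≡ ΣS m n (λ v → sum λ i → f (insertAt v p i)) ℤ.+ ΣS-punch m n p f
ΣS-insertAt m n p f = begin
  ΣS m (suc n) f
    ≡⟨ ΣV-insertAt n p (λ v → isSurj (lookup v) ⊙ f v) ⟩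
  sum (λ i → ΣV n λ v → isSurj (lookup (insertAt v p i)) ⊙ f (insertAt v p i))
    ≡⟨ sum-cong-≗ (λ i → trans (ΣV-cong n λ v → isSurj-split v p i (f (insertAt v p i)))
                               (ΣV-+ n (old i) (new f i))) ⟩
  sum (λ i → ΣV n (old i) ℤ.+ ΣV n (new f i))
    ≡⟨ ∑-distrib-+ (λ i → ΣV n (old i)) (λ i → ΣV n (new f i)) ⟩
  sum (λ i → ΣV n (old i)) ℤ.+ sum (λ i → ΣV n (new f i))
    ≡⟨ cong₂ ℤ._+_
         (trans (ΣV-sum n old)
                (ΣV-cong n λ v → sum-⊙ (isSurj (lookup v)) λ i → f (insertAt v p i)))
         (new-blocks m f) ⟩
  ΣS m n (λ v → sum λ i → f (insertAt v p i)) ℤ.+ ΣS-punch m n p f ∎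
  where
  open ≡-Reasoning
  old : Fin m → Vec (Fin m) n → ℤ
  old i v = isSurj (lookup v) ⊙ f (insertAt v p i)
  new : ∀ {m} → (Vec (Fin m) (suc n) → ℤ) → Fin m → Vec (Fin m) n → ℤ
  new f i v = misses i v ⊙ isSurj (lookup (insertAt v p i)) ⊙ f (insertAt v p i)
  new-blocks : ∀ m (f : Vec (Fin m) (suc n) → ℤ) →
               sum (λ i → ΣV n (new f i)) ≡ ΣS-punch m n p f
  new-blocks zero    f = refl
  new-blocks (suc m) f = trans
    (sum-cong-≗ λ i → trans
      (ΣV-misses n i λ v → isSurj (lookup (insertAt v p i)) ⊙ f (insertAt v p i))
      (ΣV-cong n λ v → cong (_⊙ f (punch i p v)) (isSurj-punch i p v)))
    (trans (ΣV-sum n λ i v → isSurj (lookup v) ⊙ f (punch i p v))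
           (ΣV-cong n λ v → sum-⊙ (isSurj (lookup v)) λ i → f (punch i p v)))

-- Euler characteristics of weights on set compositions

Σ< : ℕ → (ℕ → ℤ) → ℤ
Σ< zero    f = 0ℤ
Σ< (suc B) f = f 0 ℤ.+ Σ< B (f ∘ suc)

Σ<-cong : ∀ B {f g : ℕ → ℤ} → (∀ m → f m ≡ g m) → Σ< B f ≡ Σ< B g
Σ<-cong zero    h = refl
Σ<-cong (suc B) h = cong₂ ℤ._+_ (h 0) (Σ<-cong B (h ∘ suc))

Σ<-zero : ∀ B {f : ℕ → ℤ} → (∀ m → f m ≡ 0ℤ) → Σ< B f ≡ 0ℤ
Σ<-zero zero    h = refl
Σ<-zero (suc B) h = cong₂ ℤ._+_ (h 0) (Σ<-zero B (h ∘ suc))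

Σ<-+ : ∀ B (f g : ℕ → ℤ) → Σ< B (λ m → f m ℤ.+ g m) ≡ Σ< B f ℤ.+ Σ< B g
Σ<-+ zero    f g = refl
Σ<-+ (suc B) f g = trans (cong (λ z → f 0 ℤ.+ g 0 ℤ.+ z) (Σ<-+ B (f ∘ suc) (g ∘ suc)))
  (interchange (f 0) (g 0) _ _)
  where
  open import Algebra.Properties.CommutativeSemigroup ℤP.+-commutativeSemigroup using (interchange)

Σ<-neg : ∀ B (f : ℕ → ℤ) → Σ< B (λ m → - f m) ≡ - Σ< B f
Σ<-neg zero    f = refl
Σ<-neg (suc B) f = trans (cong (λ z → (- f 0) ℤ.+ z) (Σ<-neg B (f ∘ suc)))
  (sym (ℤP.neg-distrib-+ (f 0) (Σ< B (f ∘ suc))))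

Σ<-last : ∀ B (f : ℕ → ℤ) → Σ< (suc B) f ≡ Σ< B f ℤ.+ f B
Σ<-last zero    f = ℤP.+-comm (f 0) 0ℤ
Σ<-last (suc B) f = trans (cong (f 0 ℤ.+_) (Σ<-last B (f ∘ suc))) (sym (ℤP.+-assoc (f 0) _ _))

Weight : ℕ → Set
Weight n = ∀ m → Vec (Fin m) n → ℤ

-- Values of `m` beyond `n` are left out because a surjection from `Fin n` has at most `n` labels.
χ : ∀ n → Weight n → ℤ
χ n f = Σ< (suc n) λ m → sign m ℤ.* ΣS m n (f m)

χ-cong : ∀ n {f g : Weight n} → (∀ m v → f m v ≡ g m v) → χ n f ≡ χ n g
χ-cong n h = Σ<-cong (suc n) λ m → cong (sign m ℤ.*_) (ΣS-cong m n (h m))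

χ-neg : ∀ n (f : Weight n) → χ n (λ m v → - f m v) ≡ - χ n f
χ-neg n f = trans
  (Σ<-cong (suc n) λ m → trans (cong (sign m ℤ.*_) (ΣS-neg m n (f m)))
                               (sym (ℤP.neg-distribʳ-* (sign m) (ΣS m n (f m)))))
  (Σ<-neg (suc n) λ m → sign m ℤ.* ΣS m n (f m))

-- The Euler integral of f over the positions of the point p relative to the other points.
δ : ∀ {n} → Fin (suc n) → Weight (suc n) → Weight n
δ p f m v = sum (λ i → f m (insertAt v p i)) ℤ.+ - sum (λ g → f (suc m) (punch g p v))

-- Fubini: `p` either joins an existing block, with `m` unchanged, or opens a new one, which raises
-- `m` by one and flips the sign.
χ-δ : ∀ n (p : Fin (suc n)) (f : Weight (suc n)) → χ (suc n) f ≡ χ n (δ p f)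
χ-δ n p f = begin
  Σ< (2 ℕ.+ n) (λ m → sign m ℤ.* ΣS m (suc n) (f m))
    ≡⟨ Σ<-cong (2 ℕ.+ n) (λ m → trans (cong (sign m ℤ.*_) (ΣS-insertAt m n p (f m)))
         (ℤP.*-distribˡ-+ (sign m) (ΣS m n (blk m)) (ΣS-punch m n p (f m)))) ⟩
  Σ< (2 ℕ.+ n) (λ m → old m ℤ.+ new m)
    ≡⟨ Σ<-+ (2 ℕ.+ n) old new ⟩
  -- The term `new 0` is zero; the index shift aligns a new block for `p` with the `m` labels of the
  -- remaining points.
  Σ< (2 ℕ.+ n) old ℤ.+ (0ℤ ℤ.+ Σ< (suc n) (new ∘ suc))
    ≡⟨ cong₂ ℤ._+_ drop-last (ℤP.+-identityˡ (Σ< (suc n) (new ∘ suc))) ⟩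
  Σ< (suc n) old ℤ.+ Σ< (suc n) (new ∘ suc)
    ≡⟨ sym (Σ<-+ (suc n) old (new ∘ suc)) ⟩
  Σ< (suc n) (λ m → old m ℤ.+ new (suc m))
    ≡⟨ Σ<-cong (suc n) merge ⟩
  χ n (δ p f) ∎
  where
  open ≡-Reasoning
  blk gap : ∀ m → Vec (Fin m) n → ℤ
  blk m v = sum λ i → f m (insertAt v p i)
  gap m v = sum λ g → f (suc m) (punch g p v)
  old new : ℕ → ℤ
  old m = sign m ℤ.* ΣS m n (blk m)
  new m = sign m ℤ.* ΣS-punch m n p (f m)
  -- The surplus term has `suc n` labels for only `n` points.
  drop-last : Σ< (2 ℕ.+ n) old ≡ Σ< (suc n) old
  drop-last = begin
    Σ< (2 ℕ.+ n) old
      ≡⟨ Σ<-last (suc n) old ⟩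
    Σ< (suc n) old ℤ.+ sign (suc n) ℤ.* ΣS (suc n) n (blk (suc n))
      ≡⟨ cong (λ z → Σ< (suc n) old ℤ.+ sign (suc n) ℤ.* z) (ΣS-vanish ℕP.≤-refl (blk (suc n))) ⟩
    Σ< (suc n) old ℤ.+ sign (suc n) ℤ.* 0ℤ
      ≡⟨ cong (Σ< (suc n) old ℤ.+_) (ℤP.*-zeroʳ (sign (suc n))) ⟩
    Σ< (suc n) old ℤ.+ 0ℤ
      ≡⟨ ℤP.+-identityʳ (Σ< (suc n) old) ⟩
    Σ< (suc n) old ∎
  merge : ∀ m → old m ℤ.+ new (suc m) ≡ sign m ℤ.* ΣS m n (δ p f m)
  merge m = begin
    old m ℤ.+ -1ℤ ℤ.* sign m ℤ.* G
      ≡⟨ cong (λ z → old m ℤ.+ z ℤ.* G) (ℤP.-1*i≡-i (sign m)) ⟩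
    old m ℤ.+ (- sign m) ℤ.* G
      ≡⟨ cong (old m ℤ.+_) (trans (sym (ℤP.neg-distribˡ-* (sign m) G)) (ℤP.neg-distribʳ-* (sign m) G)) ⟩
    old m ℤ.+ sign m ℤ.* (- G)
      ≡⟨ sym (ℤP.*-distribˡ-+ (sign m) (ΣS m n (blk m)) (- G)) ⟩
    sign m ℤ.* (ΣS m n (blk m) ℤ.+ - G)
      ≡⟨ cong (λ z → sign m ℤ.* (ΣS m n (blk m) ℤ.+ z)) (sym (ΣS-neg m n (gap m))) ⟩
    sign m ℤ.* (ΣS m n (blk m) ℤ.+ ΣS m n (λ v → - gap m v))
      ≡⟨ cong (sign m ℤ.*_) (sym (ΣS-+ m n (blk m) (λ v → - gap m v))) ⟩
    sign m ℤ.* ΣS m n (δ p f m) ∎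
    where G = ΣS m n (gap m)

-- Constraints on labels and integration over one point

Map : ℕ → ℕ → Set
Map n m = Fin n → Fin m

-- Uniform in the number of labels, because integrating out a point compares maps before and after a
-- block is inserted.
Constraint : ℕ → Set
Constraint n = ∀ {m} → Map n m → Bool

indicator : ∀ {n} → Constraint n → Weight n
indicator C m v = C (lookup v) ⊙ 1ℤ

_∧ᶜ_ : ∀ {n} → Constraint n → Constraint n → Constraint n
(C ∧ᶜ D) φ = C φ ∧ D φ

module _ {n m m′} (φ : Map n m) (φ′ : Map n m′) where

  -- Only strict comparisons are kept; equality of labels is recovered from the failure of both
  -- directions.
  SameOrder : Fin n → Fin n → Set
  SameOrder x y = φ x Fin.< φ y ⇔ φ′ x Fin.< φ′ y

  =F-SameOrder : ∀ {x y} → SameOrder x y → SameOrder y x → (φ x =F φ y) ≡ (φ′ x =F φ′ y)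
  =F-SameOrder {x} {y} xy yx = T-ext
    (=F⁺ ∘ transport φ φ′ (Equivalence.from xy) (Equivalence.from yx) ∘ =F⁻)
    (=F⁺ ∘ transport φ′ φ (Equivalence.to xy) (Equivalence.to yx) ∘ =F⁻)
    where
    transport : ∀ {k k′} (ψ : Map n k) (ψ′ : Map n k′) → (ψ′ x Fin.< ψ′ y → ψ x Fin.< ψ y) →
                (ψ′ y Fin.< ψ′ x → ψ y Fin.< ψ x) → ψ x ≡ ψ y → ψ′ x ≡ ψ′ y
    transport ψ ψ′ f g e with FinP.<-cmp (ψ′ x) (ψ′ y)
    ... | tri< lt _ _ = contradiction (cong toℕ e) (ℕP.<⇒≢ (f lt))
    ... | tri≈ _ e′ _ = e′
    ... | tri> _ _ gt = contradiction (cong toℕ (sym e)) (ℕP.<⇒≢ (g gt))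

punchIn-< : ∀ {m} (g : Fin (suc m)) (j k : Fin m) → j Fin.< k ⇔ punchIn g j Fin.< punchIn g k
punchIn-< g j k = mk⇔
  (λ j<k → ℕP.≰⇒> λ k≤j → ℕP.<⇒≱ j<k (punchIn-cancel-≤ g k j k≤j))
  (λ j<k → ℕP.≰⇒> λ k≤j → ℕP.<⇒≱ j<k (punchIn-mono-≤ g k j k≤j))

punchIn-<-pivot : ∀ {m} (g : Fin (suc m)) (j : Fin m) → toℕ j < toℕ g ⇔ punchIn g j Fin.< g
punchIn-<-pivot zero    j       = mk⇔ (λ ()) (λ ())
punchIn-<-pivot (suc g) zero    = mk⇔ (λ _ → s≤s z≤n) (λ _ → s≤s z≤n)
punchIn-<-pivot (suc g) (suc j) = mk⇔
  (λ { (s≤s lt) → s≤s (Equivalence.to (punchIn-<-pivot g j) lt) })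
  (λ { (s≤s lt) → s≤s (Equivalence.from (punchIn-<-pivot g j) lt) })

module _ {n : ℕ} (p : Fin (suc n)) where

  IgnoresPoint : Constraint (suc n) → Set
  IgnoresPoint C = ∀ {m m′} (φ : Map (suc n) m) (φ′ : Map (suc n) m′) →
    (∀ x y → p ≢ x → p ≢ y → SameOrder φ φ′ x y) → C φ ≡ C φ′

  -- By the first clause `U` sees of `p` only which points lie strictly below it, so it cannot tell
  -- a block from the gap just below; such a pair has Euler characteristic 0. The second clause puts
  -- the unbounded top gap into the region. Conjunctions of bounds fit, and so do disjunctions with
  -- at least one term.
  LowerBound : Constraint (suc n) → Set
  LowerBound U =
    (∀ {m m′} (φ : Map (suc n) m) (φ′ : Map (suc n) m′) →
      (∀ y → p ≢ y → SameOrder φ φ′ y p) → U φ ≡ U φ′)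
    × (∀ {m} (φ : Map (suc n) m) → (∀ y → p ≢ y → φ y Fin.< φ p) → T (U φ))

  module _ {m : ℕ} (v : Vec (Fin m) n) where

    lookup-punch-≢ : ∀ g x (p≢x : p ≢ x) →
                     lookup (punch g p v) x ≡ punchIn g (lookup v (punchOut p≢x))
    lookup-punch-≢ g x p≢x =
      trans (lookup-insertAt-≢ (Vec.map (punchIn g) v) p g x p≢x) (lookup-map _ _ v)

    lookup-punch : ∀ g → lookup (punch g p v) p ≡ g
    lookup-punch g = insertAt-lookup (Vec.map (punchIn g) v) p g

    punch-order : ∀ g x y (p≢x : p ≢ x) (p≢y : p ≢ y) →
      lookup v (punchOut p≢x) Fin.< lookup v (punchOut p≢y) ⇔
      lookup (punch g p v) x Fin.< lookup (punch g p v) y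
    punch-order g x y p≢x p≢y rewrite lookup-punch-≢ g x p≢x | lookup-punch-≢ g y p≢y =
      punchIn-< g _ _

    insertAt-order : ∀ i x y (p≢x : p ≢ x) (p≢y : p ≢ y) →
      lookup v (punchOut p≢x) Fin.< lookup v (punchOut p≢y) ⇔
      lookup (insertAt v p i) x Fin.< lookup (insertAt v p i) y
    insertAt-order i x y p≢x p≢y
      rewrite lookup-insertAt-≢ v p i x p≢x | lookup-insertAt-≢ v p i y p≢y = mk⇔ id id

    pivot-order : ∀ i y → p ≢ y →
      SameOrder (lookup (insertAt v p i)) (lookup (punch (inject₁ i) p v)) y p
    pivot-order i y p≢y
      rewrite lookup-insertAt-≢ v p i y p≢y | insertAt-lookup v p i
            | lookup-punch-≢ (inject₁ i) y p≢y | lookup-punch (inject₁ i)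
      with lookup v (punchOut p≢y)
    ... | j = subst (λ k → toℕ j < k ⇔ punchIn (inject₁ i) j Fin.< inject₁ i)
                    (FinP.toℕ-inject₁ i) (punchIn-<-pivot (inject₁ i) j)

    top-order : ∀ y → p ≢ y → lookup (punch (fromℕ m) p v) y Fin.< lookup (punch (fromℕ m) p v) p
    top-order y p≢y rewrite lookup-punch-≢ (fromℕ m) y p≢y | lookup-punch (fromℕ m) =
      Equivalence.to (punchIn-<-pivot (fromℕ m) j)
        (subst (toℕ j <_) (sym (FinP.toℕ-fromℕ m)) (FinP.toℕ<n j))
      where j = lookup v (punchOut p≢y)

    module _ {C : Constraint (suc n)} (C-ignores : IgnoresPoint C) where

      ignores-insertAt : ∀ i → C (lookup (insertAt v p i)) ≡ C (lookup (punch (fromℕ m) p v))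
      ignores-insertAt i = C-ignores _ _ λ x y p≢x p≢y →
        punch-order (fromℕ m) x y p≢x p≢y ⇔-∘ ⇔-sym (insertAt-order i x y p≢x p≢y)

      ignores-punch : ∀ g → C (lookup (punch g p v)) ≡ C (lookup (punch (fromℕ m) p v))
      ignores-punch g = C-ignores _ _ λ x y p≢x p≢y →
        punch-order (fromℕ m) x y p≢x p≢y ⇔-∘ ⇔-sym (punch-order g x y p≢x p≢y)

  module _ {C : Constraint (suc n)} (C-ignores : IgnoresPoint C) where

    -- As `C` ignores `p`, any placement of `p` is a representative; alone on top is the one that
    -- survives the cancellation for a lower bound.
    rest : Weight n
    rest m v = C (lookup (punch (fromℕ m) p v)) ⊙ 1ℤ

    -- Putting p into block i, or into a new block just below block i, has the same effect on U,
    -- so all contributions cancel except that of p alone on top.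
    δ-lowerBound : {U : Constraint (suc n)} → LowerBound U → ∀ m v →
                   δ p (indicator (C ∧ᶜ U)) m v ≡ - rest m v
    δ-lowerBound {U} (U-cong , U-top) m v = begin
      sum old ℤ.+ - sum new
        ≡⟨ cong (λ z → sum old ℤ.+ - z) (sum-init-last new) ⟩
      sum old ℤ.+ - (sum (new ∘ inject₁) ℤ.+ new (fromℕ m))
        ≡⟨ cong (λ z → z ℤ.+ - (sum (new ∘ inject₁) ℤ.+ new (fromℕ m))) (sum-cong-≗ old≡new) ⟩
      sum (new ∘ inject₁) ℤ.+ - (sum (new ∘ inject₁) ℤ.+ new (fromℕ m))
        ≡⟨ cong (sum (new ∘ inject₁) ℤ.+_) (ℤP.neg-distrib-+ (sum (new ∘ inject₁)) (new (fromℕ m))) ⟩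
      sum (new ∘ inject₁) ℤ.+ (- sum (new ∘ inject₁) ℤ.+ - new (fromℕ m))
        ≡⟨ sym (ℤP.+-assoc (sum (new ∘ inject₁)) (- sum (new ∘ inject₁)) (- new (fromℕ m))) ⟩
      sum (new ∘ inject₁) ℤ.+ - sum (new ∘ inject₁) ℤ.+ - new (fromℕ m)
        ≡⟨ cong (ℤ._+ - new (fromℕ m)) (ℤP.+-inverseʳ (sum (new ∘ inject₁))) ⟩
      0ℤ ℤ.+ - new (fromℕ m)
        ≡⟨ ℤP.+-identityˡ (- new (fromℕ m)) ⟩
      - new (fromℕ m)
        ≡⟨ cong -_ top ⟩
      - rest m v ∎
      where
      open ≡-Reasoning
      old : Fin m → ℤ
      old i = indicator (C ∧ᶜ U) m (insertAt v p i)
      new : Fin (suc m) → ℤ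
      new g = indicator (C ∧ᶜ U) (suc m) (punch g p v)
      old≡new : ∀ i → old i ≡ new (inject₁ i)
      old≡new i = cong (_⊙ 1ℤ) (cong₂ _∧_
        (trans (ignores-insertAt v C-ignores i) (sym (ignores-punch v C-ignores (inject₁ i))))
        (U-cong _ _ (pivot-order v i)))
      top : new (fromℕ m) ≡ rest m v
      top = trans (⊙-∧ (C φ) (U φ) 1ℤ) (cong (C φ ⊙_) (⊙-true 1ℤ (U-top φ (top-order v))))
        where φ = lookup (punch (fromℕ m) p v)

    -- Exactly one existing block, that of `q`, satisfies the tie, and a new block never does: the
    -- fibre is a single point and gives no sign.
    δ-tie : ∀ {q} → p ≢ q → ∀ m v → δ p (indicator (C ∧ᶜ λ φ → φ p =F φ q)) m v ≡ rest m v
    δ-tie {q} p≢q m v = begin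
      sum old ℤ.+ - sum new
        ≡⟨ cong₂ (λ y z → y ℤ.+ - z)
             (trans (sum-cong-≗ old≡) (sum-single (lookup v (punchOut p≢q)) (rest m v)))
             (sum-zero new≡) ⟩
      rest m v ℤ.+ 0ℤ
        ≡⟨ ℤP.+-identityʳ (rest m v) ⟩
      rest m v ∎
      where
      open ≡-Reasoning
      old : Fin m → ℤ
      old i = indicator (C ∧ᶜ λ φ → φ p =F φ q) m (insertAt v p i)
      new : Fin (suc m) → ℤ
      new g = indicator (C ∧ᶜ λ φ → φ p =F φ q) (suc m) (punch g p v)
      old≡ : ∀ i → old i ≡ (i =F lookup v (punchOut p≢q)) ⊙ rest m v
      old≡ i rewrite insertAt-lookup v p i | lookup-insertAt-≢ v p i q p≢q
                   | ignores-insertAt v C-ignores i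
        with C (lookup (punch (fromℕ m) p v)) | i =F lookup v (punchOut p≢q)
      ... | true  | true  = refl
      ... | true  | false = refl
      ... | false | true  = refl
      ... | false | false = refl
      new≡ : ∀ g → new g ≡ 0ℤ
      new≡ g = ⊙-false 1ℤ λ t → punchInᵢ≢i g (lookup v (punchOut p≢q))
        (trans (sym (lookup-punch-≢ v g q p≢q))
        (trans (sym (=F⁻ (proj₂ (∧⁻ {C (lookup (punch g p v))} t)))) (lookup-punch v g)))

    χ-lowerBound : {U : Constraint (suc n)} → LowerBound U →
                   χ (suc n) (indicator (C ∧ᶜ U)) ≡ - χ n rest
    χ-lowerBound {U} U-bound = trans (χ-δ n p (indicator (C ∧ᶜ U)))
      (trans (χ-cong n (δ-lowerBound U-bound)) (χ-neg n rest))

    χ-tie : ∀ {q} → p ≢ q → χ (suc n) (indicator (C ∧ᶜ λ φ → φ p =F φ q)) ≡ χ n rest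
    χ-tie {q} p≢q = trans (χ-δ n p (indicator (C ∧ᶜ λ φ → φ p =F φ q))) (χ-cong n (δ-tie p≢q))

-- Total Euler characteristic of a system of constraints

indicator-cong : ∀ {n} {C D : Constraint n} → (∀ {m} (φ : Map n m) → C φ ≡ D φ) →
                 χ n (indicator C) ≡ χ n (indicator D)
indicator-cong {n} h = χ-cong n λ m v → cong (_⊙ 1ℤ) (h (lookup v))

-- The Euler characteristic of real `n`-space: the fibre of a free point is a line, which the
-- trivial lower bound treats like an open ray.
χ-one : ∀ n → χ n (indicator λ _ → true) ≡ prod {n} λ _ → -1ℤ
χ-one zero    = refl
χ-one (suc n) = trans
  (χ-lowerBound {n} zero {C = λ _ → true} (λ _ _ _ → refl)
    {U = λ _ → true} ((λ _ _ _ → refl) , λ _ _ → tt))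
  (trans (cong -_ (χ-one n)) (sym (ℤP.-1*i≡-i (prod {n} λ _ → -1ℤ))))

-- All references go to points of smaller `key`, which is what allows `x` to be integrated out
-- before them.
data Kind {n} (key : Fin n → ℕ) (x : Fin n) : Set where
  bounded : (U : Constraint n) →
    (∀ {m m′} (φ : Map n m) (φ′ : Map n m′) →
      (∀ y → key y < key x → SameOrder φ φ′ y x) → U φ ≡ U φ′) →
    (∀ {m} (φ : Map n m) → (∀ y → key y < key x → φ y Fin.< φ x) → T (U φ)) →
    Kind key x
  tied : ∀ q → key q < key x → Kind key x

constraint : ∀ {n key} {x : Fin n} → Kind key x → Constraint n
constraint (bounded U _ _) φ = U φ
constraint {x = x} (tied q _) φ = φ x =F φ q

factor : ∀ {n key} {x : Fin n} → Kind key x → ℤ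
factor (bounded _ _ _) = -1ℤ
factor (tied _ _)      = 1ℤ

module Sweep {n : ℕ} (key : Fin n → ℕ) (κ : ∀ x → Kind key x) where

  -- The sweep keeps all `n` points and switches on one condition at a time; this avoids deleting
  -- points and rewriting the other conditions on a smaller set. A pending point is still free and
  -- counts as a line, hence `-1ℤ` in `factors`.
  pending : ℕ → Fin n → Bool
  pending k x = ⌊ k ℕ.≤? key x ⌋

  upTo : ℕ → Fin n → Constraint n
  upTo k x φ = pending k x ∨ constraint (κ x) φ

  allUpTo : ℕ → Constraint n
  allUpTo k φ = allFin? λ x → upTo k x φ

  factors : ℕ → ℤ
  factors k = prod λ x → if pending k x then -1ℤ else factor (κ x)

  pending-suc : ∀ k x → key x ≢ k → pending k x ≡ pending (suc k) x
  pending-suc k x x≢k = T-ext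
    (λ t → fromWitness (ℕP.≤∧≢⇒< (toWitness t) (x≢k ∘ sym)))
    (λ t → fromWitness (ℕP.<⇒≤ (toWitness t)))

module _ {n : ℕ} (key : Fin (suc n) → ℕ) (key-injective : ∀ {x y} → key x ≡ key y → x ≡ y)
         (κ : ∀ x → Kind key x) (p : Fin (suc n)) where

  open Sweep key κ

  private
    k = key p

  -- The conditions active both before and after the one at `p` is switched on. They belong to
  -- points of smaller `key`, so none of them mentions `p`.
  others : Constraint (suc n)
  others φ = allFin? λ x → (x =F p) ∨ upTo k x φ

  <p⇒≢ : ∀ {y} → key y < k → p ≢ y
  <p⇒≢ y<p refl = ℕP.<-irrefl refl y<p

  constraint-local : ∀ {x} → key x < k → ∀ {m m′} (φ : Map (suc n) m) (φ′ : Map (suc n) m′) →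
    (∀ y z → p ≢ y → p ≢ z → SameOrder φ φ′ y z) → constraint (κ x) φ ≡ constraint (κ x) φ′
  constraint-local {x} x<p φ φ′ same with κ x
  ... | bounded U local _ = local φ φ′ λ y y<x →
          same y x (<p⇒≢ (ℕP.<-trans y<x x<p)) (<p⇒≢ x<p)
  ... | tied q q<x = =F-SameOrder φ φ′
          (same x q (<p⇒≢ x<p) (<p⇒≢ (ℕP.<-trans q<x x<p)))
          (same q x (<p⇒≢ (ℕP.<-trans q<x x<p)) (<p⇒≢ x<p))

  others-ignores : IgnoresPoint p others
  others-ignores φ φ′ same = T-ext (go φ φ′ same)
    (go φ′ φ λ x y p≢x p≢y → ⇔-sym (same x y p≢x p≢y))
    where
    go : ∀ {m m′} (φ : Map (suc n) m) (φ′ : Map (suc n) m′) →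
         (∀ x y → p ≢ x → p ≢ y → SameOrder φ φ′ x y) → T (others φ) → T (others φ′)
    go φ φ′ same t = allFin⁺ λ x → ∨⁺ {x =F p} (each x (∨⁻ {x =F p} (allFin⁻ t x)))
      where
      each : ∀ x → T (x =F p) ⊎ T (upTo k x φ) → T (x =F p) ⊎ T (upTo k x φ′)
      each x (inj₁ e) = inj₁ e
      each x (inj₂ t) with k ℕ.≤? key x
      ... | yes _ = inj₂ tt
      ... | no ≰  = inj₂ (subst T (constraint-local (ℕP.≰⇒> ≰) φ φ′ same) t)

  pending-step : ∀ x → x ≢ p → pending k x ≡ pending (suc k) x
  pending-step x x≢p = pending-suc k x (x≢p ∘ key-injective)

  before : ∀ {m} (φ : Map (suc n) m) → allUpTo k φ ≡ (others ∧ᶜ λ _ → true) φ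
  before φ = T-ext
    (λ t → ∧⁺ (allFin⁺ λ x → ∨⁺ {x =F p} (inj₂ (allFin⁻ {f = λ x → upTo k x φ} t x))) tt)
    (λ t → allFin⁺ λ x →
      [ (λ e → ∨⁺ {pending k x} (inj₁ (fromWitness {a? = k ℕ.≤? key x}
                 (ℕP.≤-reflexive (cong key (sym (=F⁻ e)))))))
      , id ]′ (∨⁻ {x =F p} (allFin⁻ (proj₁ (∧⁻ {others φ} t)) x)))

  after : ∀ {m} (φ : Map (suc n) m) →
          allUpTo (suc k) φ ≡ (others ∧ᶜ constraint (κ p)) φ
  after φ = T-ext
    (λ t → ∧⁺
      (allFin⁺ λ x → ∨⁺ {x =F p} (to x (allFin⁻ {f = λ x → upTo (suc k) x φ} t x)))
      ([ (λ s → contradiction (toWitness s) (ℕP.<-irrefl refl)) , id ]′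
        (∨⁻ {pending (suc k) p} (allFin⁻ {f = λ x → upTo (suc k) x φ} t p))))
    (λ t → let r , c = ∧⁻ {others φ} t in
      allFin⁺ λ x → from x c (∨⁻ {x =F p} (allFin⁻ r x)))
    where
    to : ∀ x → T (upTo (suc k) x φ) → T (x =F p) ⊎ T (upTo k x φ)
    to x t with x ≟F p
    ... | yes _   = inj₁ tt
    ... | no  x≢p = inj₂ (subst (λ b → T (b ∨ constraint (κ x) φ)) (sym (pending-step x x≢p)) t)
    from : ∀ x → T (constraint (κ p) φ) → T (x =F p) ⊎ T (upTo k x φ) → T (upTo (suc k) x φ)
    from x c t with x ≟F p
    from x c t        | yes refl = ∨⁺ {pending (suc k) p} (inj₂ c)
    from x c (inj₂ t) | no  x≢p  = subst (λ b → T (b ∨ constraint (κ x) φ)) (pending-step x x≢p) t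

  -- Both characteristics can be integrated over `p`, leaving the same value `R` for the remaining
  -- points: `p` free gives `- R`, `p` bounded gives `- R`, `p` tied gives `R`.
  χ-step : χ (suc n) (indicator (allUpTo (suc k)))
         ≡ (- factor (κ p)) ℤ.* χ (suc n) (indicator (allUpTo k))
  χ-step = trans (indicator-cong {C = allUpTo (suc k)} {D = others ∧ᶜ constraint (κ p)} after)
    (trans (lemma (κ p)) (cong ((- factor (κ p)) ℤ.*_) (sym
      (trans (indicator-cong {C = allUpTo k} {D = others ∧ᶜ λ _ → true} before) unbounded))))
    where
    R : ℤ
    R = χ n (rest p {C = others} others-ignores)
    unbounded : χ (suc n) (indicator (others ∧ᶜ λ _ → true)) ≡ - R
    unbounded = χ-lowerBound p {C = others} others-ignores ((λ _ _ _ → refl) , λ _ _ → tt)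
    lemma : (K : Kind key p) → χ (suc n) (indicator (others ∧ᶜ constraint K)) ≡ (- factor K) ℤ.* (- R)
    lemma (bounded U local top) = trans
      (χ-lowerBound p {C = others} others-ignores {U = U}
        ( (λ φ φ′ h → local φ φ′ λ y y<p → h y (<p⇒≢ y<p))
        , λ φ h → top φ λ y y<p → h y (<p⇒≢ y<p)))
      (sym (ℤP.*-identityˡ (- R)))
    lemma (tied q q<p) = trans
      (χ-tie p {C = others} others-ignores {q} (<p⇒≢ q<p))
      (sym (trans (ℤP.-1*i≡-i (- R)) (ℤP.neg-involutive R)))

  factors-step : factors (suc k) ≡ (- factor (κ p)) ℤ.* factors k
  factors-step = begin
    prod (term (suc k))
      ≡⟨ prod-remove {i = p} (term (suc k)) ⟩
    term (suc k) p ℤ.* prod (term (suc k) ∘ punchIn p)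
      ≡⟨ cong₂ ℤ._*_ at-suc (prod-cong λ x → cong (λ b → if b then -1ℤ else factor (κ (punchIn p x)))
            (sym (pending-step (punchIn p x) (punchInᵢ≢i p x)))) ⟩
    factor (κ p) ℤ.* R
      ≡⟨ cong (ℤ._* R) (sym (ℤP.neg-involutive (factor (κ p)))) ⟩
    (- - factor (κ p)) ℤ.* R
      ≡⟨ cong (ℤ._* R) (trans (sym (ℤP.-1*i≡-i (- factor (κ p)))) (ℤP.*-comm -1ℤ (- factor (κ p)))) ⟩
    -- The `-1ℤ` split off is the factor that `p` carried while pending.
    (- factor (κ p)) ℤ.* -1ℤ ℤ.* R
      ≡⟨ ℤP.*-assoc (- factor (κ p)) -1ℤ R ⟩
    (- factor (κ p)) ℤ.* (-1ℤ ℤ.* R)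
      ≡⟨ cong (λ z → (- factor (κ p)) ℤ.* (z ℤ.* R)) (sym at-k) ⟩
    (- factor (κ p)) ℤ.* (term k p ℤ.* R)
      ≡⟨ cong ((- factor (κ p)) ℤ.*_) (sym (prod-remove {i = p} (term k))) ⟩
    (- factor (κ p)) ℤ.* prod (term k) ∎
    where
    open ≡-Reasoning
    term : ℕ → Fin (suc n) → ℤ
    term k x = if pending k x then -1ℤ else factor (κ x)
    R : ℤ
    R = prod (term k ∘ punchIn p)
    at-k : term k p ≡ -1ℤ
    at-k with k ℕ.≤? key p
    ... | yes _ = refl
    ... | no  h = contradiction ℕP.≤-refl h
    at-suc : term (suc k) p ≡ factor (κ p)
    at-suc with suc k ℕ.≤? key p
    ... | yes h = contradiction h (ℕP.<-irrefl refl)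
    ... | no  _ = refl

module _ {n : ℕ} (key : Fin n → ℕ) (key-injective : ∀ {x y} → key x ≡ key y → x ≡ y)
         (κ : ∀ x → Kind key x) where

  open Sweep key κ

  χ-upTo : ∀ k → χ n (indicator (allUpTo k)) ≡ factors k
  χ-upTo zero = trans
    (indicator-cong {C = allUpTo 0} {D = λ _ → true}
      λ φ → T-ext (λ _ → tt) λ _ → allFin⁺ {f = λ x → upTo 0 x φ} λ x →
        ∨⁺ {pending 0 x} {constraint (κ x) φ} (inj₁ (fromWitness {a? = 0 ℕ.≤? key x} z≤n)))
    (trans (χ-one n) (prod-cong lemma))
    where
    lemma : ∀ x → -1ℤ ≡ (if pending 0 x then -1ℤ else factor (κ x))
    lemma x with 0 ℕ.≤? key x
    ... | yes _ = refl
    ... | no h  = contradiction z≤n h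
  χ-upTo (suc k) with any? (λ x → key x ℕ.≟ k) | χ-upTo k
  -- Keys need not be consecutive; at a value that no point has, no condition is switched on.
  ... | no none | ih = trans
          (indicator-cong {C = allUpTo (suc k)} {D = allUpTo k} same)
          (trans ih (prod-cong λ x →
            cong (λ b → if b then -1ℤ else factor (κ x)) (unchanged x)))
    where
    unchanged : ∀ x → pending k x ≡ pending (suc k) x
    unchanged x = pending-suc k x λ e → none (x , e)
    same : ∀ {m} (φ : Map n m) → allUpTo (suc k) φ ≡ allUpTo k φ
    same φ = T-ext
      (λ t → allFin⁺ λ x → subst (λ b → T (b ∨ constraint (κ x) φ)) (sym (unchanged x))
        (allFin⁻ {f = λ x → upTo  (suc k) x φ} t x))
      (λ t → allFin⁺ λ x → subst (λ b → T (b ∨ constraint (κ x) φ)) (unchanged x)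
        (allFin⁻ {f = λ x → upTo  k x φ} t x))
  ... | yes (p , refl) | ih = step key key-injective κ p ih
    where
    -- Stated for a general size, so that matching exposes the `suc n` over which a point can be
    -- integrated out.
    step : ∀ {n} key (inj : ∀ {x y} → key x ≡ key y → x ≡ y) κ (p : Fin n) →
      χ n (indicator (Sweep.allUpTo key κ (key p))) ≡ Sweep.factors key κ (key p) →
      χ n (indicator (Sweep.allUpTo key κ (suc (key p)))) ≡ Sweep.factors key κ (suc (key p))
    step {suc n} key inj κ p ih = trans (χ-step key inj κ p)
      (trans (cong ((- factor (κ p)) ℤ.*_) ih) (sym (factors-step key inj κ p)))

  χ-constraints : ∀ K → (∀ x → key x < K) →
    χ n (indicator λ φ → allFin? λ x → constraint (κ x) φ) ≡ prod (factor ∘ κ)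
  χ-constraints K key<K = trans
    (indicator-cong {D = allUpTo K} λ φ → T-ext
      (λ t → allFin⁺ λ x → ∨⁺ {pending K x} (inj₂ (allFin⁻ {f = λ x → constraint (κ x) φ} t x)))
      (λ t → allFin⁺ λ x → [ (λ s → contradiction (toWitness s) (ℕP.<⇒≱ (key<K x))) , id ]′
        (∨⁻ {pending K x} (allFin⁻ {f = λ x → upTo  K x φ} t x))))
    (trans (χ-upTo K) (prod-cong lemma))
    where
    lemma : ∀ x → (if pending K x then -1ℤ else factor (κ x)) ≡ factor (κ x)
    lemma x with K ℕ.≤? key x
    ... | yes h = contradiction h (ℕP.<⇒≱ (key<K x))
    ... | no _  = refl

-- Subsets, joins and equality of families

≟S⁺ : ∀ {n} {X Y : Subset n} → X ≡ Y → T (X ≟S Y)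
≟S⁺ = fromWitness

≟S⁻ : ∀ {n} {X Y : Subset n} → T (X ≟S Y) → X ≡ Y
≟S⁻ = toWitness

module _ {n : ℕ} where

  infix 4 _∋_
  _∋_ : Subset n → Fin n → Set
  X ∋ x = T (mem x X)

  subset-ext : ∀ {X Y : Subset n} → (∀ x → X ∋ x → Y ∋ x) → (∀ x → Y ∋ x → X ∋ x) → X ≡ Y
  subset-ext {X} {Y} f g = trans (sym (tabulate∘lookup X))
    (trans (tabulate-cong λ x → T-ext (f x) (g x)) (tabulate∘lookup Y))

  ⟪_⟫ : (Fin n → Bool) → Subset n
  ⟪ f ⟫ = Vec.tabulate f

  ∋-⟪⟫⁺ : ∀ f {x} → T (f x) → ⟪ f ⟫ ∋ x
  ∋-⟪⟫⁺ f {x} = subst T (sym (lookup∘tabulate f x))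

  ∋-⟪⟫⁻ : ∀ f {x} → ⟪ f ⟫ ∋ x → T (f x)
  ∋-⟪⟫⁻ f {x} = subst T (lookup∘tabulate f x)

  module _ (X Y : Subset n) {x : Fin n} where

    ∋-∩⁺ : X ∋ x → Y ∋ x → X ∩ Y ∋ x
    ∋-∩⁺ p q = subst T (sym (lookup-zipWith _∧_ x X Y)) (∧⁺ p q)

    ∋-∩⁻ : X ∩ Y ∋ x → X ∋ x × Y ∋ x
    ∋-∩⁻ p = ∧⁻ (subst T (lookup-zipWith _∧_ x X Y) p)

    ∋-∪⁺ : X ∋ x ⊎ Y ∋ x → X ∪ Y ∋ x
    ∋-∪⁺ p = subst T (sym (lookup-zipWith _∨_ x X Y)) (∨⁺ p)

    ∋-∪⁻ : X ∪ Y ∋ x → X ∋ x ⊎ Y ∋ x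
    ∋-∪⁻ p = ∨⁻ (subst T (lookup-zipWith _∨_ x X Y) p)

  ∌-⊥ : ∀ x → ¬ (⊥ ∋ x)
  ∌-⊥ x p = subst T (lookup-replicate x false) p

  ≡⊥⁺ : ∀ {X : Subset n} → (∀ x → ¬ (X ∋ x)) → X ≡ ⊥
  ≡⊥⁺ h = subset-ext (λ x p → ⊥-elim (h x p)) λ x p → ⊥-elim (∌-⊥ x p)

∈-allSubsets : ∀ {n} (X : Subset n) → X ∈L allSubsets n
∈-allSubsets []          = here refl
∈-allSubsets (true  ∷ X) = ∈-++⁺ˡ (∈-map⁺ (true ∷_) (∈-allSubsets X))
∈-allSubsets (false ∷ X) = ∈-++⁺ʳ _ (∈-map⁺ (false ∷_) (∈-allSubsets X))

module _ {n : ℕ} {F G : Family n} where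

  *⁺ : ∀ {X Y} → T (F X) → T (G Y) → T ((F * G) (X ∪ Y))
  *⁺ {X} {Y} FX GY = any⁺ _ (∈-allSubsets X) (any⁺ _ (∈-allSubsets Y)
    (∧⁺ FX (∧⁺ GY (≟S⁺ {X = X ∪ Y} refl))))

  *⁻ : ∀ {Z} → T ((F * G) Z) → ∃₂ λ X Y → T (F X) × T (G Y) × Z ≡ X ∪ Y
  *⁻ t =
    let X , tX = any⁻ _ (allSubsets n) t
        Y , tY = any⁻ _ (allSubsets n) tX
        FX , u = ∧⁻ {F X} tY
        GY , e = ∧⁻ {G Y} u
    in X , Y , FX , GY , ≟S⁻ e

  ≐?⁺ : F ≐ G → T (F ≐? G)
  ≐?⁺ h = all⁺ _ (allSubsets n) λ X → fromWitness (h X)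

  ≐?⁻ : T (F ≐? G) → F ≐ G
  ≐?⁻ t X = toWitness (all⁻ _ t (∈-allSubsets X))

-- Order ideals determine their order

Relation : ℕ → Set
Relation n = Fin n → Fin n → Bool

-- X is an order ideal of the preorder R on the set of those x with R x x.
Ideal : ∀ {n} → Relation n → Subset n → Set
Ideal R X = ∀ x → X ∋ x → T (R x x) × (∀ y → T (R y x) → X ∋ y)

record IsFragment {n} (R : Relation n) : Set where
  field
    transR : ∀ {x y z} → T (R x y) → T (R y z) → T (R x z)
    reflˡ  : ∀ {x y} → T (R x y) → T (R x x)
    reflʳ  : ∀ {x y} → T (R x y) → T (R y y)

  principal : Fin n → Subset n
  principal x = ⟪ (λ z → R z x) ⟫

  principal-ideal : ∀ x → Ideal R (principal x)
  principal-ideal x z z∈ = reflˡ Rzx , λ y Ryz → ∋-⟪⟫⁺ (λ z → R z x) (transR Ryz Rzx)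
    where Rzx = ∋-⟪⟫⁻ (λ z → R z x) z∈

module _ {n : ℕ} {R R′ : Relation n} (FR : IsFragment R) (FR′ : IsFragment R′) where
  private
    module R = IsFragment FR
    module R′ = IsFragment FR′

  -- The principal ideal of `y` under `R′` is also an ideal of `R`, so with `R x y` it contains `x`
  -- once it contains `y`. That `y` lies in the support of `R′` at all is read off its principal
  -- ideal under `R`.
  ideals-determine-⊆ : (∀ X → Ideal R X → Ideal R′ X) → (∀ X → Ideal R′ X → Ideal R X) →
                     ∀ {x y} → T (R x y) → T (R′ x y)
  ideals-determine-⊆ f g {x} {y} Rxy =
    ∋-⟪⟫⁻ (λ z → R′ z y)
      (proj₂ (g (R′.principal y) (R′.principal-ideal y) y (∋-⟪⟫⁺ (λ z → R′ z y) R′yy)) x Rxy)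
    where
    R′yy : T (R′ y y)
    R′yy = proj₁ (f (R.principal y) (R.principal-ideal y) y (∋-⟪⟫⁺ (λ z → R z y) (R.reflʳ Rxy)))

ideals-determine : ∀ {n} {R R′ : Relation n} → IsFragment R → IsFragment R′ →
  (∀ X → Ideal R X → Ideal R′ X) → (∀ X → Ideal R′ X → Ideal R X) → ∀ x y → R x y ≡ R′ x y
ideals-determine FR FR′ f g x y =
  T-ext (ideals-determine-⊆ FR FR′ f g) (ideals-determine-⊆ FR′ FR g f)

-- Order ideals left by a composition

module _ {n : ℕ} (P : FinPoset n) where
  private module P = FinPoset P
  open P using () renaming (_≤_ to _≼_)
  open IsDecPartialOrder P.isDecPartialOrder using ()
    renaming (refl to ≼-refl; trans to ≼-trans; antisym to ≼-antisym)

  leq⁺ : ∀ {x y} → x ≼ y → T (P.leq x y)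
  leq⁺ = fromWitness

  leq⁻ : ∀ {x y} → T (P.leq x y) → x ≼ y
  leq⁻ = toWitness

  JP⁺ : ∀ X → (∀ {x y} → y ≼ x → X ∋ x → X ∋ y) → T (JP P X)
  JP⁺ X h = allFin⁺ λ x → allFin⁺ λ y → ⇒⁺ {P.leq y x ∧ mem x X} λ t →
    h (leq⁻ (proj₁ (∧⁻ {P.leq y x} t))) (proj₂ (∧⁻ {P.leq y x} t))

  JP⁻ : ∀ X → T (JP P X) → ∀ {x y} → y ≼ x → X ∋ x → X ∋ y
  JP⁻ X t {x} {y} y≼x x∈ =
    ⇒⁻ {P.leq y x ∧ mem x X}
      (allFin⁻ (allFin⁻ {f = λ x → allFin? λ y → not (P.leq y x ∧ mem x X) ∨ mem y X} t x) y)
      (∧⁺ (leq⁺ y≼x) x∈)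

  module _ {m : ℕ} (φ : Fin n → Fin m) where

    -- Contraction deletes `x` exactly when some point below it lies in an earlier block, since
    -- every order ideal containing `x` contains that point.
    Survives : Fin n → Set
    Survives x = ∀ z → z ≼ x → φ x Fin.≤ φ z

    fragment : Relation n
    fragment x y = P.leq x y ∧ (φ x =F φ y) ∧ allFin? λ z → not (P.leq z y) ∨ ⌊ φ y FinP.≤? φ z ⌋

    fragment⁺ : ∀ {x y} → x ≼ y → φ x ≡ φ y → Survives y → T (fragment x y)
    fragment⁺ {y = y} x≼y e s = ∧⁺ (leq⁺ x≼y) (∧⁺ (=F⁺ e) (allFin⁺ λ z →
      ⇒⁺ {P.leq z y} λ t → fromWitness (s z (leq⁻ t))))

    fragment⁻ : ∀ {x y} → T (fragment x y) → x ≼ y × φ x ≡ φ y × Survives y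
    fragment⁻ {x} {y} t =
      let a , u = ∧⁻ {P.leq x y} t
          b , c = ∧⁻ {φ x =F φ y} u
      in leq⁻ a , =F⁻ b , λ z z≼y →
           toWitness (⇒⁻ {P.leq z y} (allFin⁻ {f = λ z → not (P.leq z y) ∨ ⌊ φ y FinP.≤? φ z ⌋} c z)
                         (leq⁺ z≼y))

    Survives-≼ : ∀ {x y} → x ≼ y → φ x ≡ φ y → Survives y → Survives x
    Survives-≼ x≼y e s z z≼x = subst (Fin._≤ φ z) (sym e) (s z (≼-trans z≼x x≼y))

    fragment-isFragment : IsFragment fragment
    fragment-isFragment = record
      { transR = λ p q → let a , b , _ = fragment⁻ p ; c , d , s = fragment⁻ q in
                         fragment⁺ (≼-trans a c) (trans b d) s
      ; reflˡ = λ p → let a , b , s = fragment⁻ p in fragment⁺ ≼-refl refl (Survives-≼ a b s)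
      ; reflʳ = λ p → let _ , _ , s = fragment⁻ p in fragment⁺ ≼-refl refl s
      }

    private
      F = JP P

      Avoids : Fin m → Subset n → Bool
      Avoids i A = allFin? λ j → if ⌊ toℕ j ℕ.<? toℕ i ⌋ then (A ∩ block φ j) ≟S ⊥ else true

    Avoids⁺ : ∀ {i A} → (∀ x → A ∋ x → i Fin.≤ φ x) → T (Avoids i A)
    Avoids⁺ {i} {A} h = allFin⁺ each
      where
      each : ∀ j → T (if ⌊ toℕ j ℕ.<? toℕ i ⌋ then (A ∩ block φ j) ≟S ⊥ else true)
      each j with toℕ j ℕ.<? toℕ i
      ... | no  _   = tt
      ... | yes j<i = ≟S⁺ (≡⊥⁺ λ x x∈ → let x∈A , x∈j = ∋-∩⁻ A (block φ j) x∈ in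
              ℕP.<⇒≱ j<i (subst (i Fin.≤_) (=F⁻ (∋-⟪⟫⁻ (λ x → φ x =F j) x∈j)) (h x x∈A)))

    Avoids⁻ : ∀ {i A} → T (Avoids i A) → ∀ x → A ∋ x → i Fin.≤ φ x
    Avoids⁻ {i} {A} t x x∈A = ℕP.≮⇒≥ λ lt → absurd lt
      (allFin⁻ {f = λ j → if ⌊ toℕ j ℕ.<? toℕ i ⌋ then (A ∩ block φ j) ≟S ⊥ else true} t (φ x))
      where
      absurd : toℕ (φ x) < toℕ i →
        ¬ T (if ⌊ toℕ (φ x) ℕ.<? toℕ i ⌋ then (A ∩ block φ (φ x)) ≟S ⊥ else true)
      absurd lt t with toℕ (φ x) ℕ.<? toℕ i
      ... | no ≮  = ≮ lt
      ... | yes _ = ∌-⊥ x (subst (_∋ x) (≟S⁻ {X = A ∩ block φ (φ x)} t)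
                      (∋-∩⁺ A (block φ (φ x)) x∈A (∋-⟪⟫⁺ (λ y → φ y =F φ x) (=F⁺ {i = φ x} refl))))

    restrictContract⁻ : ∀ {i Y} → T (restrictContract φ F i Y) →
                        Ideal fragment Y × (∀ x → Y ∋ x → φ x ≡ i)
    restrictContract⁻ {i} {Y} t
      with any⁻ (λ A → F A ∧ Avoids i A ∧ (Y ≟S (A ∩ block φ i))) (allSubsets n) t
    ... | A , u with ∧⁻ {F A} u
    ...   | JA , u′ with ∧⁻ {Avoids i A} u′
    ...     | avoid , e with ≟S⁻ {X = Y} e
    ...       | refl = ideal , λ x x∈ → block⁻ (proj₂ (∋-∩⁻ A (block φ i) x∈))
      where
      block⁻ : ∀ {x} → block φ i ∋ x → φ x ≡ i
      block⁻ x∈ = =F⁻ (∋-⟪⟫⁻ (λ x → φ x =F i) x∈)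
      ideal : Ideal fragment (A ∩ block φ i)
      ideal x x∈ = fragment⁺ ≼-refl refl
          (λ z z≼x → subst (Fin._≤ φ z) (sym φx≡i) (Avoids⁻ avoid z (JP⁻ A JA z≼x x∈A)))
        , λ y Ryx → let y≼x , e , _ = fragment⁻ Ryx in
            ∋-∩⁺ A (block φ i) (JP⁻ A JA y≼x x∈A) (∋-⟪⟫⁺ (λ x → φ x =F i) (=F⁺ (trans e φx≡i)))
        where
        x∈A = proj₁ (∋-∩⁻ A (block φ i) x∈)
        φx≡i = block⁻ (proj₂ (∋-∩⁻ A (block φ i) x∈))

    -- The witness is the down-closure of `Y` in `P`. It avoids the earlier blocks because the
    -- points of `Y` survive, and meets block `i` only in `Y` because `Y` is an ideal of `fragment`.
    restrictContract⁺ : ∀ {i Y} → Ideal fragment Y → (∀ x → Y ∋ x → φ x ≡ i) →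
                        T (restrictContract φ F i Y)
    restrictContract⁺ {i} {Y} ideal inBlock =
      any⁺ (λ A → F A ∧ Avoids i A ∧ (Y ≟S (A ∩ block φ i))) (∈-allSubsets ↓Y)
        (∧⁺ (JP⁺ ↓Y λ {x} {y} y≼x x∈ → let z , x≼z , z∈ = ↓Y⁻ x∈ in ↓Y⁺ (≼-trans y≼x x≼z) z∈)
        (∧⁺ (Avoids⁺ above) (≟S⁺ {X = Y} (subset-ext
          (λ x x∈ → ∋-∩⁺ ↓Y (block φ i) (↓Y⁺ ≼-refl x∈) (∋-⟪⟫⁺ (λ x → φ x =F i) (=F⁺ (inBlock x x∈))))
          λ x x∈ → back x (∋-∩⁻ ↓Y (block φ i) x∈)))))
      where
      below : Fin n → Bool
      below x = anyFin λ z → P.leq x z ∧ mem z Y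
      ↓Y = ⟪ below ⟫
      ↓Y⁺ : ∀ {x z} → x ≼ z → Y ∋ z → ↓Y ∋ x
      ↓Y⁺ {z = z} x≼z z∈ = ∋-⟪⟫⁺ below (anyFin⁺ z (∧⁺ (leq⁺ x≼z) z∈))
      ↓Y⁻ : ∀ {x} → ↓Y ∋ x → ∃ λ z → x ≼ z × Y ∋ z
      ↓Y⁻ {x} x∈ = let z , t = anyFin⁻ (∋-⟪⟫⁻ below x∈) ; a , b = ∧⁻ {P.leq x z} t in z , leq⁻ a , b
      survives : ∀ {z} → Y ∋ z → Survives z
      survives z∈ = proj₂ (proj₂ (fragment⁻ (proj₁ (ideal _ z∈))))
      above : ∀ x → ↓Y ∋ x → i Fin.≤ φ x
      above x x∈ = let z , x≼z , z∈ = ↓Y⁻ x∈ in subst (Fin._≤ φ x) (inBlock z z∈) (survives z∈ x x≼z)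
      back : ∀ x → ↓Y ∋ x × block φ i ∋ x → Y ∋ x
      back x (x∈ , x∈i) = let z , x≼z , z∈ = ↓Y⁻ x∈ in
        proj₂ (ideal z z∈) x (fragment⁺ x≼z
          (trans (=F⁻ (∋-⟪⟫⁻ (λ x → φ x =F i) x∈i)) (sym (inBlock z z∈))) (survives z∈))

    joins : List (Fin m) → Family n
    joins = List.foldr (λ i G → restrictContract φ F i * G) unitFam

    joins⁻ : ∀ is {Z} → T (joins is Z) → Ideal fragment Z × (∀ x → Z ∋ x → φ x ∈L is)
    joins⁻ [] {Z} t with ≟S⁻ {X = Z} t
    ... | refl = (λ x x∈ → ⊥-elim (∌-⊥ x x∈)) , λ x x∈ → ⊥-elim (∌-⊥ x x∈)
    joins⁻ (i ∷ is) {Z} t with *⁻ {F = restrictContract φ F i} {G = joins is} t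
    ... | X , Y , tX , tY , refl with restrictContract⁻ tX | joins⁻ is tY
    ...   | idX , inX | idY , inY = ideal , λ x x∈ →
              [ here ∘ inX x , there ∘ inY x ]′ (∋-∪⁻ X Y x∈)
      where
      ideal : Ideal fragment (X ∪ Y)
      ideal x x∈ with ∋-∪⁻ X Y x∈
      ... | inj₁ x∈X = proj₁ (idX x x∈X) , λ y r → ∋-∪⁺ X Y (inj₁ (proj₂ (idX x x∈X) y r))
      ... | inj₂ x∈Y = proj₁ (idY x x∈Y) , λ y r → ∋-∪⁺ X Y (inj₂ (proj₂ (idY x x∈Y) y r))

    -- `fragment` relates only points with equal labels, so cutting an ideal along a set of labels
    -- leaves ideals: label `i` goes to the first factor, all others to the rest of the list.
    joins⁺ : ∀ is {Z} → Ideal fragment Z → (∀ x → Z ∋ x → φ x ∈L is) → T (joins is Z)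
    joins⁺ [] {Z} ideal h = ≟S⁺ (≡⊥⁺ λ x x∈ → contradiction (h x x∈) λ ())
    joins⁺ (i ∷ is) {Z} ideal h = subst (T ∘ joins (i ∷ is)) (sym Z≡)
      (*⁺ {F = restrictContract φ F i} {G = joins is}
        (restrictContract⁺ (part-ideal inI λ e → subst (λ j → T (j =F i)) (sym e))
                           (λ x x∈ → =F⁻ (proj₂ (part⁻ inI x∈))))
        (joins⁺ is (part-ideal notI λ e → subst (λ j → T (not (j =F i))) (sym e))
          λ x x∈ → drop (proj₂ (part⁻ notI x∈)) (h x (proj₁ (part⁻ notI x∈)))))
      where
      inI notI : Fin n → Bool
      inI x = φ x =F i
      notI x = not (φ x =F i)
      part : (Fin n → Bool) → Subset n
      part f = ⟪ (λ x → mem x Z ∧ f x) ⟫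
      part⁻ : ∀ f {x} → part f ∋ x → Z ∋ x × T (f x)
      part⁻ f {x} x∈ = ∧⁻ {mem x Z} (∋-⟪⟫⁻ (λ x → mem x Z ∧ f x) x∈)
      part⁺ : ∀ f {x} → Z ∋ x → T (f x) → part f ∋ x
      part⁺ f x∈ t = ∋-⟪⟫⁺ (λ x → mem x Z ∧ f x) (∧⁺ x∈ t)
      part-ideal : ∀ f → (∀ {x y} → φ y ≡ φ x → T (f x) → T (f y)) → Ideal fragment (part f)
      part-ideal f f-cong x x∈ = let x∈Z , fx = part⁻ f x∈ in
        proj₁ (ideal x x∈Z) , λ y r →
          part⁺ f (proj₂ (ideal x x∈Z) y r) (f-cong (proj₁ (proj₂ (fragment⁻ r))) fx)
      Z≡ : Z ≡ part inI ∪ part notI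
      Z≡ = subset-ext
        (λ x x∈ → ∋-∪⁺ (part inI) (part notI)
          ([ inj₁ ∘ part⁺ inI x∈ , inj₂ ∘ part⁺ notI x∈ ∘ not⁺ ]′ (T-dec (inI x))))
        (λ x x∈ → [ proj₁ ∘ part⁻ inI , proj₁ ∘ part⁻ notI ]′ (∋-∪⁻ (part inI) (part notI) x∈))
      drop : ∀ {j} → T (not (j =F i)) → j ∈L (i ∷ is) → j ∈L is
      drop t (here e)  = ⊥-elim (not⁻ t (=F⁺ e))
      drop t (there p) = p

    μΔ⁺ : ∀ X → Ideal fragment X → T (μΔ φ F X)
    μΔ⁺ X ideal = joins⁺ (allFin m) ideal λ x _ → ∈-allFin (φ x)

    μΔ⁻ : ∀ X → T (μΔ φ F X) → Ideal fragment X
    μΔ⁻ X t = proj₁ (joins⁻ (allFin m) t)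

-- Order ideals of a fracturing

module _ {n : ℕ} {P : FinPoset n} (Q : Fracturing P) where
  private module P = FinPoset P
  open Fracturing Q
  open IsDecPartialOrder P.isDecPartialOrder using () renaming (trans to ≼-trans)

  leqQ⁻ : ∀ {x y} → T (leqQ Q x y) →
          S ∋ x × S ∋ y × (x ≡ y ⊎ (summand x ≡ summand y × P._≤_ x y))
  leqQ⁻ {x} {y} t =
    let a , u = ∧⁻ {mem x S} t
        b , v = ∧⁻ {mem y S} u
    in a , b , [ inj₁ ∘ =F⁻
               , (λ w → let c , d = ∧⁻ {summand x =F summand y} w in inj₂ (=F⁻ c , leq⁻ P d)) ]′
               (∨⁻ {x =F y} v)

  leqQ⁺ : ∀ {x y} → S ∋ x → S ∋ y → x ≡ y ⊎ (summand x ≡ summand y × P._≤_ x y) → T (leqQ Q x y)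
  leqQ⁺ {x} {y} a b c = ∧⁺ a (∧⁺ b (∨⁺ {x =F y}
    ([ inj₁ ∘ =F⁺ , (λ (d , e) → inj₂ (∧⁺ (=F⁺ d) (leq⁺ P e))) ]′ c)))

  leqQ-trans : ∀ {x y z} → T (leqQ Q x y) → T (leqQ Q y z) → T (leqQ Q x z)
  leqQ-trans p q with leqQ⁻ p | leqQ⁻ q
  ... | x∈ , _ , inj₁ refl    | _ , z∈ , c             = leqQ⁺ x∈ z∈ c
  ... | x∈ , _ , inj₂ c       | _ , z∈ , inj₁ refl     = leqQ⁺ x∈ z∈ (inj₂ c)
  ... | x∈ , _ , inj₂ (e , a) | _ , z∈ , inj₂ (e′ , b) = leqQ⁺ x∈ z∈ (inj₂ (trans e e′ , ≼-trans a b))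

  leqQ-isFragment : IsFragment (leqQ Q)
  leqQ-isFragment = record
    { transR = leqQ-trans
    ; reflˡ  = λ p → let a , _ = leqQ⁻ p in leqQ⁺ a a (inj₁ refl)
    ; reflʳ  = λ p → let _ , b , _ = leqQ⁻ p in leqQ⁺ b b (inj₁ refl)
    }

  JQ⁺ : ∀ X → Ideal (leqQ Q) X → T (JQ Q X)
  JQ⁺ X ideal = ∧⁺
    (allFin⁺ λ x → ⇒⁺ {mem x X} λ x∈ → proj₁ (leqQ⁻ (proj₁ (ideal x x∈))))
    (allFin⁺ λ x → allFin⁺ λ y → ⇒⁺ {leqQ Q y x ∧ mem x X} λ t →
      let r , x∈ = ∧⁻ {leqQ Q y x} t in proj₂ (ideal x x∈) y r)

  JQ⁻ : ∀ X → T (JQ Q X) → Ideal (leqQ Q) X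
  JQ⁻ X t x x∈ =
    let a , b = ∧⁻ {allFin? λ x → not (mem x X) ∨ mem x S} t
        x∈S = ⇒⁻ {mem x X} (allFin⁻ {f = λ x → not (mem x X) ∨ mem x S} a x) x∈
    in leqQ⁺ x∈S x∈S (inj₁ refl) , λ y r →
       ⇒⁻ {leqQ Q y x ∧ mem x X}
         (allFin⁻ (allFin⁻ {f = λ x → allFin? λ y → not (leqQ Q y x ∧ mem x X) ∨ mem y X} b x) y)
         (∧⁺ r x∈)

module _ {n : ℕ} {P : FinPoset n} where

  JQ-injective : ∀ (Q Q′ : Fracturing P) → JQ Q ≐ JQ Q′ → SamePoset Q Q′
  JQ-injective Q Q′ h = subset-ext (to Q Q′ leq≡) (to Q′ Q λ x y → sym (leq≡ x y)) , leq≡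
    where
    leq≡ : ∀ x y → leqQ Q x y ≡ leqQ Q′ x y
    leq≡ = ideals-determine (leqQ-isFragment Q) (leqQ-isFragment Q′)
      (λ X i → JQ⁻ Q′ X (subst T (h X) (JQ⁺ Q X i))) (λ X i → JQ⁻ Q X (subst T (sym (h X)) (JQ⁺ Q′ X i)))
    to : (Q Q′ : Fracturing P) → (∀ x y → leqQ Q x y ≡ leqQ Q′ x y) →
         ∀ x → Fracturing.S Q ∋ x → Fracturing.S Q′ ∋ x
    to Q Q′ e x x∈ = proj₁ (leqQ⁻ Q′ (subst T (e x x) (leqQ⁺ Q x∈ x∈ (inj₁ refl))))

  module _ {m : ℕ} (φ : Fin n → Fin m) (Q : Fracturing P) where

    μΔ≐JQ⁻ : μΔ φ (JP P) ≐ JQ Q → ∀ x y → fragment P φ x y ≡ leqQ Q x y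
    μΔ≐JQ⁻ h = ideals-determine (fragment-isFragment P φ) (leqQ-isFragment Q)
      (λ X i → JQ⁻ Q X (subst T (h X) (μΔ⁺ P φ X i)))
      (λ X i → μΔ⁻ P φ X (subst T (sym (h X)) (JQ⁺ Q X i)))

    μΔ≐JQ⁺ : (∀ x y → fragment P φ x y ≡ leqQ Q x y) → μΔ φ (JP P) ≐ JQ Q
    μΔ≐JQ⁺ h X = T-ext
      (λ t → JQ⁺ Q X λ x x∈ → let a , b = μΔ⁻ P φ X t x x∈ in
        subst T (h x x) a , λ y r → b y (subst T (sym (h y x)) r))
      (λ t → μΔ⁺ P φ X λ x x∈ → let a , b = JQ⁻ Q X t x x∈ in
        subst T (sym (h x x)) a , λ y r → b y (subst T (h y x) r))

  -- Blocks serve as summands. Summand labels live in `Fin n`, and block numbers embed there because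
  -- surjectivity gives `m ≤ n`.
  fracturingOf : ∀ {m} (φ : Fin n → Fin m) → (∀ i → ∃ λ x → φ x ≡ i) → Fracturing P
  fracturingOf φ surj = record
    { S       = ⟪ (λ x → fragment P φ x x) ⟫
    ; summand = λ x → Fin.inject≤ (φ x) (surj⇒≤ surj)
    }

  fragment≡leqQ : ∀ {m} (φ : Fin n → Fin m) surj x y →
                  fragment P φ x y ≡ leqQ (fracturingOf φ surj) x y
  fragment≡leqQ φ surj x y = T-ext
    (λ t → let a , b , _ = fragment⁻ P φ t in
      leqQ⁺ Q (∋-⟪⟫⁺ (λ x → fragment P φ x x) (reflˡ t)) (∋-⟪⟫⁺ (λ x → fragment P φ x x) (reflʳ t))
              (inj₂ (cong (λ i → Fin.inject≤ i (surj⇒≤ surj)) b , a)))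
    (λ t → back (leqQ⁻ Q t))
    where
    Q = fracturingOf φ surj
    open IsFragment (fragment-isFragment P φ)
    back : Fracturing.S Q ∋ x × Fracturing.S Q ∋ y ×
           (x ≡ y ⊎ (Fracturing.summand Q x ≡ Fracturing.summand Q y × FinPoset._≤_ P x y)) →
           T (fragment P φ x y)
    back (x∈ , y∈ , inj₁ refl)    = ∋-⟪⟫⁻ (λ x → fragment P φ x x) x∈
    back (x∈ , y∈ , inj₂ (e , a)) = fragment⁺ P φ a (FinP.inject≤-injective _ _ _ _ e)
      (proj₂ (proj₂ (fragment⁻ P φ (∋-⟪⟫⁻ (λ x → fragment P φ x x) y∈))))

∣∣-strict : ∀ {n} (X Y : Subset n) → (∀ x → X ∋ x → Y ∋ x) → ∀ z → Y ∋ z → ¬ (X ∋ z) → ∣ X ∣ < ∣ Y ∣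
∣∣-strict X Y X⊆Y z z∈Y z∉X = p⊂q⇒∣p∣<∣q∣ {p = X} {q = Y}
  ( (λ {x} x∈ → lookup⇒[]= x Y (Equivalence.to T-≡ (X⊆Y x (Equivalence.from T-≡ ([]=⇒lookup x∈)))))
  , z , lookup⇒[]= z Y (Equivalence.to T-≡ z∈Y) , λ z∈ → z∉X (Equivalence.from T-≡ ([]=⇒lookup z∈)))

-- Connectivity of the Hasse diagram

module Connectivity {n : ℕ} {P : FinPoset n} (Q : Fracturing P) where
  open Fracturing Q
  open IsDecPartialOrder (FinPoset.isDecPartialOrder P) using (antisym)
  open IsFragment (leqQ-isFragment Q) renaming (transR to leqQ-transitive)

  leqQ-antisym : ∀ {x y} → T (leqQ Q x y) → T (leqQ Q y x) → x ≡ y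
  leqQ-antisym p q with leqQ⁻ Q p | leqQ⁻ Q q
  ... | _ , _ , inj₁ e       | _                    = e
  ... | _                    | _ , _ , inj₁ e       = sym e
  ... | _ , _ , inj₂ (_ , a) | _ , _ , inj₂ (_ , b) = antisym a b

  ltQ⁻ : ∀ {x y} → T (ltQ Q x y) → T (leqQ Q x y) × x ≢ y
  ltQ⁻ {x} {y} t = let a , b = ∧⁻ {leqQ Q x y} t in a , not⁻ b ∘ =F⁺

  ltQ⁺ : ∀ {x y} → T (leqQ Q x y) → x ≢ y → T (ltQ Q x y)
  ltQ⁺ a b = ∧⁺ a (not⁺ (b ∘ =F⁻))

  ltQ-trans : ∀ {x y z} → T (ltQ Q x y) → T (ltQ Q y z) → T (ltQ Q x z)
  ltQ-trans p q with ltQ⁻ p | ltQ⁻ q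
  ... | a , _ | b , y≢z = ltQ⁺ (leqQ-transitive a b) λ { refl → y≢z (leqQ-antisym b a) }

  Edge : Fin n → Fin n → Set
  Edge x y = T (hasseEdge Q x y)

  Path : Fin n → Fin n → Set
  Path = Star Edge

  Edge-sym : ∀ {x y} → Edge x y → Edge y x
  Edge-sym {x} {y} = subst T (∨-comm (coversQ Q x y) (coversQ Q y x))

  Path-sym : ∀ {x y} → Path x y → Path y x
  Path-sym = reverse Edge-sym

  between : Fin n → Fin n → Fin n → Bool
  between x y z = ltQ Q x z ∧ ltQ Q z y

  interval : Fin n → Fin n → Subset n
  interval x y = ⟪ between x y ⟫

  -- A point strictly between splits the open interval into two, both smaller because they lack that
  -- point; `k` bounds the size and drives the recursion. An empty interval is a cover.
  ltQ⇒Path : ∀ k x y → T (ltQ Q x y) → ∣ interval x y ∣ < k → Path x y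
  ltQ⇒Path (suc k) x y x<y (s≤s size) with T-dec (anyFin (between x y))
  ... | inj₂ none = ∨⁺ {coversQ Q x y} (inj₁ (∧⁺ x<y (not⁺ none))) ◅ ε
  ... | inj₁ some with anyFin⁻ {f = between x y} some
  ...   | z , x<z<y with ∧⁻ {ltQ Q x z} x<z<y
  ...     | x<z , z<y =
              ltQ⇒Path k x z x<z (ℕP.<-≤-trans
                (∣∣-strict (interval x z) (interval x y) left z z∈ z∉left) size)
           ◅◅ ltQ⇒Path k z y z<y (ℕP.<-≤-trans
                (∣∣-strict (interval z y) (interval x y) right z z∈ z∉right) size)
    where
    z∈ : interval x y ∋ z
    z∈ = ∋-⟪⟫⁺ (between x y) x<z<y
    left : ∀ w → interval x z ∋ w → interval x y ∋ w
    left w w∈ = let a , b = ∧⁻ {ltQ Q x w} (∋-⟪⟫⁻ (between x z) w∈) in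
      ∋-⟪⟫⁺ (between x y) (∧⁺ a (ltQ-trans b z<y))
    right : ∀ w → interval z y ∋ w → interval x y ∋ w
    right w w∈ = let a , b = ∧⁻ {ltQ Q z w} (∋-⟪⟫⁻ (between z y) w∈) in
      ∋-⟪⟫⁺ (between x y) (∧⁺ (ltQ-trans x<z a) b)
    irrefl : ¬ T (ltQ Q z z)
    irrefl t = proj₂ (ltQ⁻ t) refl
    z∉left : ¬ (interval x z ∋ z)
    z∉left t = irrefl (proj₂ (∧⁻ {ltQ Q x z} (∋-⟪⟫⁻ (between x z) t)))
    z∉right : ¬ (interval z y ∋ z)
    z∉right t = irrefl (proj₁ (∧⁻ {ltQ Q z z} (∋-⟪⟫⁻ (between z y) t)))

  leqQ⇒Path : ∀ {x y} → T (leqQ Q x y) → Path x y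
  leqQ⇒Path {x} {y} t = by-cases (x ≟F y)
    where
    by-cases : Dec (x ≡ y) → Path x y
    by-cases (yes refl) = ε
    by-cases (no x≢y)   = ltQ⇒Path (suc ∣ interval x y ∣) x y (ltQ⁺ t x≢y) ℕP.≤-refl

  reach⇒Path : ∀ t {x y} → T (reach Q t x y) → S ∋ x × Path x y
  reach⇒Path zero {x} {y} r with ∧⁻ {mem x S} r
  ... | x∈ , e with =F⁻ {i = x} {y} e
  ...   | refl = x∈ , ε
  reach⇒Path (suc t) {x} {y} r with ∨⁻ {reach Q t x y} r
  ... | inj₁ r′ = reach⇒Path t r′
  ... | inj₂ r′ with anyFin⁻ {f = λ z → reach Q t x z ∧ hasseEdge Q z y} r′
  ...   | z , r″ with ∧⁻ {reach Q t x z} r″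
  ...     | xz , zy = let x∈ , path = reach⇒Path t xz in x∈ , path ◅◅ (zy ◅ ε)

  module _ (x : Fin n) where

    ball : ℕ → Subset n
    ball t = ⟪ reach Q t x ⟫

    reach-mono : ∀ t {y} → T (reach Q t x y) → T (reach Q (suc t) x y)
    reach-mono t {y} r = ∨⁺ {reach Q t x y} (inj₁ r)

    Closed : ℕ → Set
    Closed t = ∀ {z y} → T (reach Q t x z) → Edge z y → T (reach Q t x y)

    Stable : ℕ → Set
    Stable t = ∀ {y} → T (reach Q (suc t) x y) → T (reach Q t x y)

    Closed⇒Stable : ∀ t → Closed t → Stable t
    Closed⇒Stable t closed {y} r with ∨⁻ {reach Q t x y} r
    ... | inj₁ r′ = r′
    ... | inj₂ r′ with anyFin⁻ {f = λ z → reach Q t x z ∧ hasseEdge Q z y} r′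
    ...   | z , r″ with ∧⁻ {reach Q t x z} r″
    ...     | xz , zy = closed xz zy

    Stable⇒Closed : ∀ t → Stable t → Closed t
    Stable⇒Closed t stable {z} {y} xz zy =
      stable {y} (∨⁺ {reach Q t x y} (inj₂ (anyFin⁺ z (∧⁺ xz zy))))

    Closed-suc : ∀ t → Closed t → Closed (suc t)
    Closed-suc t closed xz zy = reach-mono t (closed (Closed⇒Stable t closed xz) zy)

    -- `connected` searches only `n` rounds. Until the ball is closed under edges each round adds a
    -- point, so an unclosed ball after `n` rounds would hold more than `n` points.
    closed-or-large : ∀ t → Closed t ⊎ t < ∣ ball t ∣
    closed-or-large zero with T-dec (mem x S)
    ... | inj₂ x∉ = inj₁ λ {z} r → ⊥-elim (x∉ (proj₁ (∧⁻ {mem x S} r)))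
    ... | inj₁ x∈ = inj₂ (ℕP.≤-<-trans z≤n (∣∣-strict ⊥ (ball 0)
            (λ y y∈ → ⊥-elim (∌-⊥ y y∈)) x (∋-⟪⟫⁺ (reach Q 0 x) (∧⁺ x∈ (=F⁺ {i = x} refl))) (∌-⊥ x)))
    closed-or-large (suc t) with closed-or-large t
    ... | inj₁ closed = inj₁ (Closed-suc t closed)
    ... | inj₂ large with T-dec (anyFin λ y → reach Q (suc t) x y ∧ not (reach Q t x y))
    ...   | inj₂ none = inj₁ (Closed-suc t (Stable⇒Closed t stable))
      where
      stable : Stable t
      stable {y} r with T-dec (reach Q t x y)
      ... | inj₁ r′ = r′
      ... | inj₂ ¬r = ⊥-elim (none (anyFin⁺ y (∧⁺ r (not⁺ ¬r))))
    ...   | inj₁ some with anyFin⁻ {f = λ y → reach Q (suc t) x y ∧ not (reach Q t x y)} some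
    ...     | y , new with ∧⁻ {reach Q (suc t) x y} new
    ...       | r , ¬r = inj₂ (ℕP.≤-<-trans large (∣∣-strict (ball t) (ball (suc t))
                  (λ z z∈ → ∋-⟪⟫⁺ (reach Q (suc t) x) (reach-mono t (∋-⟪⟫⁻ (reach Q t x) z∈)))
                  y (∋-⟪⟫⁺ (reach Q (suc t) x) r) (not⁻ ¬r ∘ ∋-⟪⟫⁻ (reach Q t x))))

    connected-closed : Closed n
    connected-closed with closed-or-large n
    ... | inj₁ closed = closed
    ... | inj₂ large  = contradiction (∣p∣≤n (ball n)) (ℕP.<⇒≱ large)

    connected-refl : S ∋ x → T (connected Q x x)
    connected-refl x∈ = go n
      where
      go : ∀ t → T (reach Q t x x)
      go zero    = ∧⁺ x∈ (=F⁺ {i = x} refl)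
      go (suc t) = reach-mono t (go t)

  Path⇒connected : ∀ {x y} → S ∋ x → Path x y → T (connected Q x y)
  Path⇒connected {x} x∈ = go (connected-refl x x∈)
    where
    go : ∀ {z y} → T (connected Q x z) → Path z y → T (connected Q x y)
    go r ε        = r
    go r (e ◅ es) = go (connected-closed x r e) es

  connected⇒Path : ∀ {x y} → T (connected Q x y) → S ∋ x × Path x y
  connected⇒Path = reach⇒Path n

  Edge⇒leqQ : ∀ {x y} → Edge x y → T (leqQ Q x y) ⊎ T (leqQ Q y x)
  Edge⇒leqQ {x} {y} e with ∨⁻ {coversQ Q x y} e
  ... | inj₁ c = inj₁ (proj₁ (ltQ⁻ (proj₁ (∧⁻ {ltQ Q x y} c))))
  ... | inj₂ c = inj₂ (proj₁ (ltQ⁻ (proj₁ (∧⁻ {ltQ Q y x} c))))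

  Path-∈S : ∀ {x y} → S ∋ x → Path x y → S ∋ y
  Path-∈S x∈ ε        = x∈
  Path-∈S x∈ (e ◅ es) = Path-∈S (Edge-target e) es
    where
    Edge-target : ∀ {x y} → Edge x y → S ∋ y
    Edge-target e = [ proj₁ ∘ proj₂ ∘ leqQ⁻ Q , proj₁ ∘ leqQ⁻ Q ]′ (Edge⇒leqQ e)

  Path-respects : ∀ {A : Set} (f : Fin n → A) → (∀ {x y} → T (leqQ Q x y) → f x ≡ f y) →
                  ∀ {x y} → Path x y → f x ≡ f y
  Path-respects f h ε        = refl
  Path-respects f h (e ◅ es) =
    trans ([ h , (λ r → sym (h r)) ]′ (Edge⇒leqQ e)) (Path-respects f h es)

-- Compositions inducing a given fracturing

module Characterisation {n : ℕ} {P : FinPoset n} (Q : Fracturing P) where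
  open Fracturing Q
  open Connectivity Q
  open FinPoset P using (leq) renaming (_≤_ to _≼_)
  open IsDecPartialOrder (FinPoset.isDecPartialOrder P) using ()
    renaming (refl to ≼-refl; trans to ≼-trans)

  Induces : ∀ {m} → Map n m → Set
  Induces φ = ∀ x y → fragment P φ x y ≡ leqQ Q x y

  -- Repeats the test inside `components`, so that the points of `S` without an earlier one are
  -- literally those counted there.
  earlier : Fin n → Fin n → Bool
  earlier x y = ⌊ toℕ y ℕ.<? toℕ x ⌋ ∧ connected Q y x

  hasEarlier : Fin n → Bool
  hasEarlier x = anyFin (earlier x)

  leqQ-refl : ∀ {x} → S ∋ x → T (leqQ Q x x)
  leqQ-refl x∈ = leqQ⁺ Q x∈ x∈ (inj₁ refl)

  -- Labels are constant on components, so `x` may be any point of the component of `x′`; this lets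
  -- the bound be attached to the representative alone.
  Exceeds : ∀ {m} → Map n m → Set
  Exceeds φ = ∀ {x x′ y} → T (connected Q x x′) → S ∋ y → x′ ≼ y → ¬ T (leqQ Q x′ y) → φ y Fin.< φ x

  LostElements : ∀ {m} → Map n m → Set
  LostElements φ = ∀ {x} → ¬ (S ∋ x) → ∃ λ y → S ∋ y × y ≼ x × φ y Fin.< φ x

  Constant : ∀ {m} → Map n m → Set
  Constant φ = ∀ {x y} → T (connected Q x y) → φ x ≡ φ y

  module _ {m : ℕ} {φ : Map n m} where

    module _ (induces : Induces φ) where

      leqQ⇒fragment : ∀ {x y} → T (leqQ Q x y) → T (fragment P φ x y)
      leqQ⇒fragment {x} {y} = subst T (sym (induces x y))

      fragment⇒leqQ : ∀ {x y} → T (fragment P φ x y) → T (leqQ Q x y)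
      fragment⇒leqQ {x} {y} = subst T (induces x y)

      ∈S⇒Survives : ∀ {x} → S ∋ x → Survives P φ x
      ∈S⇒Survives x∈ = proj₂ (proj₂ (fragment⁻ P φ (leqQ⇒fragment (leqQ-refl x∈))))

      Survives⇒∈S : ∀ {x} → Survives P φ x → S ∋ x
      Survives⇒∈S s = proj₁ (leqQ⁻ Q (fragment⇒leqQ (fragment⁺ P φ ≼-refl refl s)))

      constant : Constant φ
      constant c = Path-respects φ
        (λ r → proj₁ (proj₂ (fragment⁻ P φ (leqQ⇒fragment r)))) (proj₂ (connected⇒Path c))

      -- Since `y` survives, its label is at most that of `x′` below it; equal labels would relate
      -- `x′` and `y` in the induced order, hence in `Q`.
      exceeds : Exceeds φ
      exceeds {x} {x′} {y} c y∈ x′≼y ¬x′≤y = ℕP.≤∧≢⇒<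
        (subst (φ y Fin.≤_) (sym (constant c)) (∈S⇒Survives y∈ x′ x′≼y))
        λ e → ¬x′≤y (fragment⇒leqQ (fragment⁺ P φ x′≼y
          (trans (sym (constant c)) (sym (FinP.toℕ-injective e))) (∈S⇒Survives y∈)))

      -- A removed point does not survive, so some point below it has a smaller label. If that one
      -- is removed too, repeat: labels strictly decrease, so the descent ends at a point of `Q`.
      lost : LostElements φ
      lost {x} = descend (suc (toℕ (φ x))) x ℕP.≤-refl
        where
        descend : ∀ k x → toℕ (φ x) < k → ¬ (S ∋ x) → ∃ λ y → S ∋ y × y ≼ x × φ y Fin.< φ x
        descend (suc k) x (s≤s φx≤k) x∉
          with any? (λ z → FinPoset._≤?_ P z x ×-dec (φ z FinP.<? φ x))
        ... | no  none = contradiction (Survives⇒∈S λ z z≼x → ℕP.≮⇒≥ λ lt → none (z , z≼x , lt)) x∉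
        ... | yes (z , z≼x , z<x) with T-dec (mem z S)
        ...   | inj₁ z∈ = z , z∈ , z≼x , z<x
        ...   | inj₂ z∉ with descend k z (ℕP.<-≤-trans z<x φx≤k) z∉
        ...     | y , y∈ , y≼z , y<z = y , y∈ , ≼-trans y≼z z≼x , ℕP.<-trans y<z z<x

    -- The least point of a component represents it, so the strict bounds need only be imposed there.
    module _ (ties : ∀ x → S ∋ x → T (hasEarlier x) → ∃ λ y → T (earlier x y) × φ x ≡ φ y)
             (bounds : ∀ {x x′ y} → S ∋ x → ¬ T (hasEarlier x) → T (connected Q x x′) → S ∋ y →
                       x′ ≼ y → ¬ T (leqQ Q x′ y) → φ y Fin.< φ x)
             (lost : LostElements φ) where

      -- Each tie leads to a smaller index in the same component, so following ties ends at the
      -- representative with the label unchanged.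
      least : ∀ k x → toℕ x < k → S ∋ x → ∃ λ r → T (connected Q r x) × ¬ T (hasEarlier r) × φ r ≡ φ x
      least (suc k) x (s≤s x≤k) x∈ with T-dec (hasEarlier x)
      ... | inj₂ none = x , connected-refl x x∈ , none , refl
      ... | inj₁ some with ties x x∈ some
      ...   | y , t , e with ∧⁻ {⌊ toℕ y ℕ.<? toℕ x ⌋} t
      ...     | y<x , c with connected⇒Path c
      ...       | y∈ , y~x with least k y (ℕP.<-≤-trans (toWitness y<x) x≤k) y∈
      ...         | r , r~y , r-least , e′ with connected⇒Path r~y
      ...           | r∈ , path = r , Path⇒connected r∈ (path ◅◅ y~x) , r-least , trans e′ (sym e)

      root : ∀ x → S ∋ x → ∃ λ r → T (connected Q r x) × ¬ T (hasEarlier r) × φ r ≡ φ x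
      root x = least (suc (toℕ x)) x ℕP.≤-refl

      least-unique : ∀ {r r′} → T (connected Q r r′) → ¬ T (hasEarlier r) → ¬ T (hasEarlier r′) → r ≡ r′
      least-unique {r} {r′} c l l′ with FinP.<-cmp r r′
      ... | tri< lt _ _ = ⊥-elim (l′ (anyFin⁺ r (∧⁺ (fromWitness lt) c)))
      ... | tri≈ _ e _  = e
      ... | tri> _ _ gt with connected⇒Path c
      ...   | r∈ , path = ⊥-elim (l (anyFin⁺ r′ (∧⁺ (fromWitness gt)
                (Path⇒connected (Path-∈S r∈ path) (Path-sym path)))))

      Path-constant : ∀ {x y} → S ∋ x → S ∋ y → Path x y → φ x ≡ φ y
      Path-constant {x} {y} x∈ y∈ path with root x x∈ | root y y∈
      ... | r , r~x , l , e | r′ , r′~y , l′ , e′ with connected⇒Path r~x | connected⇒Path r′~y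
      ...   | r∈ , p | _ , p′ with least-unique (Path⇒connected r∈ (p ◅◅ path ◅◅ Path-sym p′)) l l′
      ...     | refl = trans (sym e) e′

      antitone : ∀ {w y} → S ∋ w → S ∋ y → w ≼ y → φ y Fin.≤ φ w
      antitone {w} {y} w∈ y∈ w≼y with T-dec (leqQ Q w y)
      ... | inj₁ r = ℕP.≤-reflexive (cong toℕ (sym (Path-constant w∈ y∈ (leqQ⇒Path r))))
      ... | inj₂ ¬r with root w w∈
      ...   | r , c , l , e = subst (φ y Fin.≤_) e
                (ℕP.<⇒≤ (bounds (proj₁ (connected⇒Path c)) l c y∈ w≼y ¬r))

      -- A removed `z` below `y` has by `lost` a kept `w` below it with a smaller label; `w` lies
      -- below `y` too, so the comparison within `Q` applies to it.
      survives : ∀ {y} → S ∋ y → Survives P φ y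
      survives {y} y∈ z z≼y with T-dec (mem z S)
      ... | inj₁ z∈ = antitone z∈ y∈ z≼y
      ... | inj₂ z∉ with lost z∉
      ...   | w , w∈ , w≼z , w<z = ℕP.≤-trans (antitone w∈ y∈ (≼-trans w≼z z≼y)) (ℕP.<⇒≤ w<z)

      Survives⇒∈S⁺ : ∀ {x} → Survives P φ x → S ∋ x
      Survives⇒∈S⁺ {x} s with T-dec (mem x S)
      ... | inj₁ x∈ = x∈
      ... | inj₂ x∉ with lost x∉
      ...   | w , _ , w≼x , w<x = contradiction (s w w≼x) (ℕP.<⇒≱ w<x)

      induces⁺ : Induces φ
      induces⁺ x y = T-ext forth back
        where
        back : T (leqQ Q x y) → T (fragment P φ x y)
        back r with leqQ⁻ Q r
        ... | x∈ , y∈ , c = fragment⁺ P φ ([ (λ { refl → ≼-refl }) , proj₂ ]′ c)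
                (Path-constant x∈ y∈ (leqQ⇒Path r)) (survives y∈)
        forth : T (fragment P φ x y) → T (leqQ Q x y)
        forth t with fragment⁻ P φ t | T-dec (leqQ Q x y)
        ... | _           | inj₁ r  = r
        ... | x≼y , e , s | inj₂ ¬r with Survives⇒∈S⁺ (Survives-≼ P φ x≼y e s)
        ...   | x∈ with root x x∈
        ...     | r , c , l , e′ = contradiction (trans (sym e) (sym e′)) λ y≡r →
                    ℕP.<⇒≢ (bounds (proj₁ (connected⇒Path c)) l c (Survives⇒∈S⁺ s) x≼y ¬r) (cong toℕ y≡r)

-- The constraint system of a good fracturing

module Weights {n : ℕ} {P : FinPoset n} (Q : Fracturing P)
               {m₀ : ℕ} (φ₀ : Map n m₀) (induces₀ : Characterisation.Induces Q φ₀) where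
  open Fracturing Q
  open Connectivity Q
  open Characterisation Q
  open FinPoset P using (leq) renaming (_≤_ to _≼_)

  -- Removed points rank above every label, since their bounds refer to points of `Q` only.
  rank : Fin n → Fin (suc m₀)
  rank x = if mem x S then inject₁ (φ₀ x) else fromℕ m₀

  -- `combine` gives the lexicographic order of rank and index. The index separates points of equal
  -- rank and puts the representative first in its component.
  key : Fin n → ℕ
  key x = toℕ (combine (rank x) x)

  key-injective : ∀ {x y} → key x ≡ key y → x ≡ y
  key-injective {x} {y} e = FinP.combine-injectiveʳ (rank x) x (rank y) y (FinP.toℕ-injective e)

  rank-∈ : ∀ {x} → S ∋ x → rank x ≡ inject₁ (φ₀ x)
  rank-∈ {x} x∈ with mem x S
  ... | true = refl

  rank-∉ : ∀ {x} → ¬ (S ∋ x) → rank x ≡ fromℕ m₀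
  rank-∉ {x} x∉ with mem x S
  ... | true  = ⊥-elim (x∉ tt)
  ... | false = refl

  key-< : ∀ {x y} → rank y Fin.< rank x → key y < key x
  key-< {x} {y} = FinP.combine-monoˡ-< y x

  key-<-outside : ∀ {x y} → S ∋ y → ¬ (S ∋ x) → key y < key x
  key-<-outside {x} {y} y∈ x∉ = key-< {x} {y} (subst₂ Fin._<_ (sym (rank-∈ y∈)) (sym (rank-∉ x∉))
    (subst₂ _<_ (sym (FinP.toℕ-inject₁ (φ₀ y))) (sym (FinP.toℕ-fromℕ m₀)) (FinP.toℕ<n (φ₀ y))))

  key-<-label : ∀ {x y} → S ∋ y → S ∋ x → φ₀ y Fin.< φ₀ x → key y < key x
  key-<-label {x} {y} y∈ x∈ lt = key-< {x} {y} (subst₂ Fin._<_ (sym (rank-∈ y∈)) (sym (rank-∈ x∈))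
    (subst₂ _<_ (sym (FinP.toℕ-inject₁ (φ₀ y))) (sym (FinP.toℕ-inject₁ (φ₀ x))) lt))

  key-<-index : ∀ {x y} → S ∋ y → S ∋ x → φ₀ y ≡ φ₀ x → y Fin.< x → key y < key x
  key-<-index {x} {y} y∈ x∈ e lt = subst₂ _<_
    (sym (FinP.toℕ-combine (rank y) y)) (sym (FinP.toℕ-combine (rank x) x))
    (subst (λ c → n ℕ.* toℕ (rank y) + toℕ y < n ℕ.* toℕ c + toℕ x)
      (trans (rank-∈ y∈) (trans (cong inject₁ e) (sym (rank-∈ x∈))))
      (ℕP.+-monoʳ-< (n ℕ.* toℕ (rank y)) lt))

  lower : ∀ {m} → Map n m → Fin n → Fin n → Bool
  lower φ x y = ⌊ φ y FinP.<? φ x ⌋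

  lower-cong : ∀ {m m′} (φ : Map n m) (φ′ : Map n m′) {x y} → SameOrder φ φ′ y x →
               lower φ x y ≡ lower φ′ x y
  lower-cong φ φ′ h = T-ext
    (λ t → fromWitness (Equivalence.to h (toWitness t)))
    (λ t → fromWitness (Equivalence.from h (toWitness t)))

  support : Fin n → Fin n → Bool
  support x y = mem y S ∧ leq y x

  aboveSupport : Fin n → Constraint n
  aboveSupport x φ = anyFin λ y → support x y ∧ lower φ x y

  support-key : ∀ {x y} → ¬ (S ∋ x) → T (support x y) → key y < key x
  support-key {x} {y} x∉ t = key-<-outside {x} {y} (proj₁ (∧⁻ {mem y S} t)) x∉

  -- By `exceeds`, any composition inducing `Q` must give these points labels below that of the
  -- component of `x`.
  blocked : Fin n → Fin n → Bool
  blocked x y = mem y S ∧ anyFin λ x′ → connected Q x x′ ∧ leq x′ y ∧ not (leqQ Q x′ y)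

  aboveBlocked : Fin n → Constraint n
  aboveBlocked x φ = allFin? λ y → not (blocked x y) ∨ lower φ x y

  blocked⁺ : ∀ {x x′ y} → T (connected Q x x′) → S ∋ y → x′ ≼ y → ¬ T (leqQ Q x′ y) → T (blocked x y)
  blocked⁺ {x} {x′} {y} c y∈ x′≼y ¬r = ∧⁺ y∈ (anyFin⁺ x′ (∧⁺ c (∧⁺ (leq⁺ P x′≼y) (not⁺ ¬r))))

  blocked⁻ : ∀ {x y} → T (blocked x y) →
             S ∋ y × ∃ λ x′ → T (connected Q x x′) × x′ ≼ y × ¬ T (leqQ Q x′ y)
  blocked⁻ {x} {y} t =
    let y∈ , u = ∧⁻ {mem y S} t
        x′ , v = anyFin⁻ {f = λ x′ → connected Q x x′ ∧ leq x′ y ∧ not (leqQ Q x′ y)} u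
        c , w  = ∧⁻ {connected Q x x′} v
        l , ¬r = ∧⁻ {leq x′ y} w
    in y∈ , x′ , c , leq⁻ P l , not⁻ ¬r

  blocked-key : ∀ {x y} → S ∋ x → T (blocked x y) → key y < key x
  blocked-key {x} {y} x∈ t =
    let y∈ , x′ , c , l , ¬r = blocked⁻ {x} {y} t
    in key-<-label {x} {y} y∈ x∈ (exceeds induces₀ c y∈ l ¬r)

  earlier⁻ : ∀ {x y} → T (earlier x y) → y Fin.< x × T (connected Q y x)
  earlier⁻ {x} {y} t = let lt , c = ∧⁻ {⌊ toℕ y ℕ.<? toℕ x ⌋} t in toWitness lt , c

  earlier-key : ∀ {x y} → S ∋ x → T (earlier x y) → key y < key x
  earlier-key {x} {y} x∈ t = let lt , c = earlier⁻ {x} {y} t in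
    key-<-index {x} {y} (proj₁ (connected⇒Path c)) x∈ (constant induces₀ c) lt

  -- Goodness enters through `induces₀`: it places blocked and tied points at a smaller `key`, and
  -- it supplies each removed point with a point of `Q` below it, without which the disjunction
  -- `aboveSupport` would be unsatisfiable. The two decisions are arguments so that later proofs can
  -- split on them.
  kind : ∀ x → S ∋ x ⊎ ¬ (S ∋ x) → T (hasEarlier x) ⊎ ¬ T (hasEarlier x) → Kind key x
  kind x (inj₁ x∈) (inj₁ e) = let y , t = anyFin⁻ {f = earlier x} e in tied y (earlier-key {x} {y} x∈ t)
  kind x (inj₁ x∈) (inj₂ _) = bounded (aboveBlocked x)
    (λ φ φ′ same → T-ext (transfer φ φ′ same) (transfer φ′ φ λ y lt → ⇔-sym (same y lt)))
    (λ φ top → allFin⁺ λ y → ⇒⁺ {blocked x y} λ b → fromWitness (top y (blocked-key {x} {y} x∈ b)))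
    where
    transfer : ∀ {m m′} (φ : Map n m) (φ′ : Map n m′) →
      (∀ y → key y < key x → SameOrder φ φ′ y x) → T (aboveBlocked x φ) → T (aboveBlocked x φ′)
    transfer φ φ′ same t = allFin⁺ λ y → ⇒⁺ {blocked x y} λ b →
      subst T (lower-cong φ φ′ (same y (blocked-key {x} {y} x∈ b)))
        (⇒⁻ {blocked x y} (allFin⁻ {f = λ y → not (blocked x y) ∨ lower φ x y} t y) b)
  kind x (inj₂ x∉) _ = bounded (aboveSupport x)
    (λ φ φ′ same → T-ext (transfer φ φ′ same) (transfer φ′ φ λ y lt → ⇔-sym (same y lt)))
    (λ φ top → let y , y∈ , y≼x , _ = lost induces₀ x∉
                   s = ∧⁺ y∈ (leq⁺ P y≼x) in
      anyFin⁺ y (∧⁺ s (fromWitness (top y (support-key {x} {y} x∉ s)))))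
    where
    transfer : ∀ {m m′} (φ : Map n m) (φ′ : Map n m′) →
      (∀ y → key y < key x → SameOrder φ φ′ y x) → T (aboveSupport x φ) → T (aboveSupport x φ′)
    transfer φ φ′ same t =
      let y , u = anyFin⁻ {f = λ y → support x y ∧ lower φ x y} t
          s , l = ∧⁻ {support x y} u
      in anyFin⁺ y (∧⁺ s (subst T (lower-cong φ φ′ (same y (support-key {x} {y} x∉ s))) l))

  κ : ∀ x → Kind key x
  κ x = kind x (T-dec (mem x S)) (T-dec (hasEarlier x))

  satisfies : Constraint n
  satisfies φ = allFin? λ x → constraint (κ x) φ

  module _ {m : ℕ} {φ : Map n m} where

    satisfies⁺ : Induces φ → T (satisfies φ)
    satisfies⁺ induces = allFin⁺ λ x → holds x (T-dec (mem x S)) (T-dec (hasEarlier x))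
      where
      holds : ∀ x a b → T (constraint (kind x a b) φ)
      holds x (inj₁ x∈) (inj₁ e) = =F⁺ (sym (constant induces
        (proj₂ (earlier⁻ {x} (proj₂ (anyFin⁻ {f = earlier x} e))))))
      holds x (inj₁ x∈) (inj₂ _) = allFin⁺ λ y → ⇒⁺ {blocked x y} λ b →
        let y∈ , x′ , c , l , ¬r = blocked⁻ {x} {y} b in fromWitness (exceeds induces c y∈ l ¬r)
      holds x (inj₂ x∉) _ = let y , y∈ , y≼x , lt = lost induces x∉ in
        anyFin⁺ y (∧⁺ (∧⁺ {mem y S} y∈ (leq⁺ P y≼x)) (fromWitness lt))

    satisfies⁻ : T (satisfies φ) → Induces φ
    satisfies⁻ t = induces⁺ ties bounds lost′
      where
      each : ∀ x → T (constraint (κ x) φ)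
      each = allFin⁻ {f = λ x → constraint (κ x) φ} t
      ties : ∀ x → S ∋ x → T (hasEarlier x) → ∃ λ y → T (earlier x y) × φ x ≡ φ y
      ties x x∈ e = go (T-dec (mem x S)) (T-dec (hasEarlier x)) (each x)
        where
        go : ∀ a b → T (constraint (kind x a b) φ) → ∃ λ y → T (earlier x y) × φ x ≡ φ y
        go (inj₁ _)  (inj₁ e) c = let y , s = anyFin⁻ {f = earlier x} e in y , s , =F⁻ c
        go (inj₁ _)  (inj₂ f) c = contradiction e f
        go (inj₂ x∉) _        c = contradiction x∈ x∉
      bounds : ∀ {x x′ y} → S ∋ x → ¬ T (hasEarlier x) → T (connected Q x x′) → S ∋ y →
               x′ ≼ y → ¬ T (leqQ Q x′ y) → φ y Fin.< φ x
      bounds {x} {x′} {y} x∈ l c y∈ x′≼y ¬r = go (T-dec (mem x S)) (T-dec (hasEarlier x)) (each x)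
        where
        go : ∀ a b → T (constraint (kind x a b) φ) → φ y Fin.< φ x
        go (inj₁ _)  (inj₁ e) _ = contradiction e l
        go (inj₁ _)  (inj₂ _) s = toWitness (⇒⁻ {blocked x y}
          (allFin⁻ {f = λ y → not (blocked x y) ∨ lower φ x y} s y) (blocked⁺ {x} {x′} {y} c y∈ x′≼y ¬r))
        go (inj₂ x∉) _        _ = contradiction x∈ x∉
      lost′ : LostElements φ
      lost′ {x} x∉ = go (T-dec (mem x S)) (T-dec (hasEarlier x)) (each x)
        where
        go : ∀ a b → T (constraint (kind x a b) φ) → ∃ λ y → S ∋ y × y ≼ x × φ y Fin.< φ x
        go (inj₁ x∈) _ _ = contradiction x∈ x∉
        go (inj₂ _)  _ s =
          let y , u = anyFin⁻ {f = λ y → support x y ∧ lower φ x y} s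
              v , l = ∧⁻ {support x y} u
              y∈ , y≼x = ∧⁻ {mem y S} v
          in y , y∈ , leq⁻ P y≼x , toWitness l

  χ-satisfies : χ n (indicator satisfies) ≡ prod (factor ∘ κ)
  χ-satisfies = χ-constraints key key-injective κ (suc m₀ ℕ.* n) λ x → FinP.toℕ<n (combine (rank x) x)

  isRoot : Fin n → Bool
  isRoot x = mem x S ∧ not (hasEarlier x)

  -- Separates the sign of representatives from the sign of removed points, so that the product
  -- splits into one power of `-1ℤ` for each.
  factor-κ : ∀ x → (if isRoot x then -1ℤ else 1ℤ) ℤ.* (if mem x S then 1ℤ else -1ℤ) ≡ factor (κ x)
  factor-κ x with T-dec (mem x S) | T-dec (hasEarlier x)
  ... | inj₁ x∈ | inj₁ e = cong₂ ℤ._*_ (if-false (λ t → not⁻ (proj₂ (∧⁻ {mem x S} t)) e)) (if-true x∈)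
  ... | inj₁ x∈ | inj₂ l = cong₂ ℤ._*_ (if-true (∧⁺ x∈ (not⁺ l))) (if-true x∈)
  ... | inj₂ x∉ | _      = cong₂ ℤ._*_ (if-false (x∉ ∘ proj₁ ∘ ∧⁻ {mem x S})) (if-false x∉)

-- Signs, list sums and the coefficients of the antipode

sign-length-filter : ∀ {A : Set} {k} (g : A → Bool) (f : Fin k → A) →
  sign (length (filter (λ x → T? (g x)) (tabulate f))) ≡ prod λ i → if g (f i) then -1ℤ else 1ℤ
sign-length-filter {k = zero}  g f = refl
sign-length-filter {k = suc k} g f with g (f zero)
... | true  = cong (-1ℤ ℤ.*_) (sign-length-filter g (f ∘ suc))
... | false = trans (sign-length-filter g (f ∘ suc))
                    (sym (ℤP.*-identityˡ (prod λ i → if g (f (suc i)) then -1ℤ else 1ℤ)))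

sign-codim : ∀ {n} (S : Subset n) → sign (n ∸ ∣ S ∣) ≡ prod λ x → if mem x S then 1ℤ else -1ℤ
sign-codim []          = refl
sign-codim (true  ∷ S) = trans (sign-codim S)
  (sym (ℤP.*-identityˡ (prod λ x → if mem x S then 1ℤ else -1ℤ)))
-- Subtraction is truncated: `suc` moves out of it only because `∣ S ∣` is at most the size of the
-- ground set.
sign-codim (false ∷ S) = trans (cong sign (ℕP.+-∸-assoc 1 (∣p∣≤n S))) (cong (-1ℤ ℤ.*_) (sign-codim S))

ΣL : List ℤ → ℤ
ΣL = List.foldr ℤ._+_ 0ℤ

ΣL-++ : ∀ xs ys → ΣL (xs ++ ys) ≡ ΣL xs ℤ.+ ΣL ys
ΣL-++ []       ys = sym (ℤP.+-identityˡ (ΣL ys))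
ΣL-++ (x ∷ xs) ys = trans (cong (x ℤ.+_) (ΣL-++ xs ys)) (sym (ℤP.+-assoc x (ΣL xs) (ΣL ys)))

ΣL-applyUpTo : ∀ (f : ℕ → List ℤ) (g : ℕ → ℕ) B →
               ΣL (concatMap f (applyUpTo g B)) ≡ Σ< B (λ m → ΣL (f (g m)))
ΣL-applyUpTo f g zero    = refl
ΣL-applyUpTo f g (suc B) = trans (ΣL-++ (f (g 0)) (concatMap f (applyUpTo (g ∘ suc) B)))
  (cong (λ z → ΣL (f (g 0)) ℤ.+ z) (ΣL-applyUpTo f (g ∘ suc) B))

ΣL-tabulate : ∀ {A B : Set} {k} (h : B → ℤ) (f : A → List B) (g : Fin k → A) →
  ΣL (List.map h (concatMap f (tabulate g))) ≡ sum (λ i → ΣL (List.map h (f (g i))))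
ΣL-tabulate {k = zero}  h f g = refl
ΣL-tabulate {k = suc k} h f g = trans
  (cong ΣL (map-++ h (f (g zero)) (concatMap f (tabulate (g ∘ suc)))))
  (trans (ΣL-++ (List.map h (f (g zero))) (List.map h (concatMap f (tabulate (g ∘ suc)))))
         (cong (λ z → ΣL (List.map h (f (g zero))) ℤ.+ z) (ΣL-tabulate h f (g ∘ suc))))

ΣL-allVecs : ∀ {m} n (h : Vec (Fin m) n → ℤ) → ΣL (List.map h (allVecs m n)) ≡ ΣV n h
ΣL-allVecs zero    h = ℤP.+-identityʳ (h [])
ΣL-allVecs {m} (suc n) h = trans (ΣL-tabulate h (λ i → List.map (i ∷_) (allVecs m n)) id)
  (sum-cong-≗ λ i → trans (cong ΣL (sym (map-∘ (allVecs m n)))) (ΣL-allVecs n (h ∘ (i ∷_))))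

sum-*ˡ : ∀ {k} s (f : Fin k → ℤ) → sum (λ i → s ℤ.* f i) ≡ s ℤ.* sum f
sum-*ˡ {zero}  s f = sym (ℤP.*-zeroʳ s)
sum-*ˡ {suc k} s f = trans (cong (λ z → s ℤ.* f zero ℤ.+ z) (sum-*ˡ s (f ∘ suc)))
  (sym (ℤP.*-distribˡ-+ s (f zero) (sum (f ∘ suc))))

ΣV-*ˡ : ∀ {m} n s (f : Vec (Fin m) n → ℤ) → ΣV n (λ v → s ℤ.* f v) ≡ s ℤ.* ΣV n f
ΣV-*ˡ zero    s f = refl
ΣV-*ˡ (suc n) s f = trans (sum-cong-≗ λ i → ΣV-*ˡ n s (f ∘ (i ∷_))) (sum-*ˡ s λ i → ΣV n (f ∘ (i ∷_)))

module _ {n : ℕ} (F G : Family n) where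

  yields : Constraint n
  yields φ = μΔ φ F ≐? G

  antipodeCoeff≡χ : antipodeCoeff F G ≡ χ n (indicator yields)
  antipodeCoeff≡χ = trans
    (ΣL-applyUpTo (λ m → List.map (term m) (allVecs m n)) id (suc n))
    (Σ<-cong (suc n) λ m → trans (ΣL-allVecs n (term m))
      (trans (ΣV-cong n λ v → split (isSurj (lookup v)) (yields (lookup v)) (sign m))
             (ΣV-*ˡ n (sign m) λ v → isSurj (lookup v) ⊙ yields (lookup v) ⊙ 1ℤ)))
    where
    term : Weight n
    term m v = if isSurj (lookup v) ∧ yields (lookup v) then sign m else 0ℤ
    split : ∀ a b s → (if a ∧ b then s else 0ℤ) ≡ s ℤ.* (a ⊙ b ⊙ 1ℤ)
    split true  true  s = sym (ℤP.*-identityʳ s)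
    split true  false s = sym (ℤP.*-zeroʳ s)
    split false _     s = sym (ℤP.*-zeroʳ s)

module _ {n : ℕ} (P : FinPoset n) (G : Family n) where

  antipodeCoeff-good : (Q : Fracturing P) → Good P Q → JQ Q ≐ G →
                       antipodeCoeff (JP P) G ≡ sign (components Q + removed Q)
  antipodeCoeff-good Q (Φ , μΔ≐JQ) JQ≐G = begin
    antipodeCoeff (JP P) G
      ≡⟨ antipodeCoeff≡χ (JP P) G ⟩
    χ n (indicator (yields (JP P) G))
      ≡⟨ indicator-cong {C = yields (JP P) G} {D = satisfies} yields≡satisfies ⟩
    χ n (indicator satisfies)
      ≡⟨ χ-satisfies ⟩
    prod (factor ∘ κ)
      ≡⟨ prod-cong (sym ∘ factor-κ) ⟩
    prod (λ x → (if isRoot x then -1ℤ else 1ℤ) ℤ.* (if mem x S then 1ℤ else -1ℤ))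
      ≡⟨ prod-* (λ x → if isRoot x then -1ℤ else 1ℤ) (λ x → if mem x S then 1ℤ else -1ℤ) ⟩
    prod (λ x → if isRoot x then -1ℤ else 1ℤ) ℤ.* prod (λ x → if mem x S then 1ℤ else -1ℤ)
      ≡⟨ cong₂ ℤ._*_ (sym (sign-length-filter isRoot id)) (sym (sign-codim S)) ⟩
    sign (components Q) ℤ.* sign (removed Q)
      ≡⟨ sym (ℤP.^-distribˡ-+-* -1ℤ (components Q) (removed Q)) ⟩
    sign (components Q + removed Q) ∎
    where
    open ≡-Reasoning
    open Fracturing Q
    open Weights Q (Composition.φ Φ) (μΔ≐JQ⁻ (Composition.φ Φ) Q μΔ≐JQ)
    -- Ideals determine the order, so producing `G` amounts to inducing `Q`.
    yields≡satisfies : ∀ {m} (φ : Map n m) → yields (JP P) G φ ≡ satisfies φ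
    yields≡satisfies φ = T-ext
      (λ t → satisfies⁺ (μΔ≐JQ⁻ φ Q λ X → trans (≐?⁻ t X) (sym (JQ≐G X))))
      (λ t → ≐?⁺ λ X → trans (μΔ≐JQ⁺ φ Q (satisfies⁻ t) X) (JQ≐G X))

  -- Every surjection produces the ideals of its own fracturing, which is thereby good; so no
  -- surjection can produce `G`, and each term vanishes.
  antipodeCoeff-bad : (∀ (Q : Fracturing P) → Good P Q → ¬ (JQ Q ≐ G)) → antipodeCoeff (JP P) G ≡ 0ℤ
  antipodeCoeff-bad bad = trans (antipodeCoeff≡χ (JP P) G) (Σ<-zero (suc n) λ m →
    trans (cong (sign m ℤ.*_) (ΣV-zero n (vanish m))) (ℤP.*-zeroʳ (sign m)))
    where
    vanish : ∀ m (v : Vec (Fin m) n) → isSurj (lookup v) ⊙ yields (JP P) G (lookup v) ⊙ 1ℤ ≡ 0ℤ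
    vanish m v with T-dec (isSurj (lookup v))
    ... | inj₂ ¬s = ⊙-false _ ¬s
    ... | inj₁ s  = trans (⊙-true _ s) (⊙-false 1ℤ λ t →
      let Q = fracturingOf {P = P} (lookup v) surj
          μΔ≐JQ = μΔ≐JQ⁺ (lookup v) Q (fragment≡leqQ {P = P} (lookup v) surj)
      in bad Q (record { m = m ; φ = lookup v ; surj = surj } , μΔ≐JQ)
             λ X → trans (sym (μΔ≐JQ X)) (≐?⁻ t X))
      where surj = isSurj⁻ {φ = lookup v} s

-- The identity is read coefficient by coefficient. Injectivity on good fracturings ensures that at
-- most one of them contributes to a given basis element, so nothing is grouped.
theorem4p15 : ∀ {n : ℕ} (P : FinPoset n) →
      (∀ (Q Q' : Fracturing P) → Good P Q → Good P Q' → JQ Q ≐ JQ Q' → SamePoset Q Q')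
    × (∀ (G : Family n) →
          (∀ (Q : Fracturing P) → Good P Q → JQ Q ≐ G →
             antipodeCoeff (JP P) G ≡ sign (components Q + removed Q))
        × ((∀ (Q : Fracturing P) → Good P Q → ¬ (JQ Q ≐ G)) →
             antipodeCoeff (JP P) G ≡ 0ℤ))
theorem4p15 P = (λ Q Q' _ _ → JQ-injective Q Q') , λ G → antipodeCoeff-good P G , antipodeCoeff-bad P G
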